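{- Let $n\ge 3$ be an integer and let $\overline{F_n}$ denote the complement of the friendship graph $F_n$. Then $\overline{F_n}$ is determined by its adjacency spectrum: every graph $H$ that is cospectral with $\overline{F_n}$ is isomorphic to $\overline{F_n}$.
   Context: All graphs are finite, simple and undirected. The friendship graph $F_n$ ($n\ge 1$) is the graph with $2n+1$ vertices and $3n$ edges obtained from $n$ copies of the triangle $C_3$ by identifying one vertex of each copy into a single common vertex. Two graphs are cospectral if their $(0,1)$-adjacency matrices have the same multiset of eigenvalues. -}

module Defs where

open import Level using (Level; _⊔_)
open import Algebra.Apartness.Bundles using (HeytingField; HeytingCommutativeRing)
open import Algebra.Bundles using (CommutativeRing)
open import Algebra.Bundles.Raw using (RawRing)
import Algebra.Definitions.RawMonoid as RawMonoidDefs
import Algebra.Definitions.RawSemiring as RawSemiringDefs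
open import Data.Bool.Base using (Bool; true; false; not; _∧_; if_then_else_)
open import Data.Fin.Base using (Fin; zero; suc; toℕ; punchIn; quotient)
open import Data.Fin.Permutation using (Permutation; _⟨$⟩ʳ_)
open import Data.Fin.Properties using (_≟_)
open import Data.List.Base using (List; []; _∷_; map; foldr)
import Data.List.Relation.Binary.Permutation.Setoid as Permutationₛ
open import Data.Nat.Base using (ℕ; zero; suc) renaming (_*_ to _*ℕ_)
open import Data.Product.Base using (Σ-syntax; ∃-syntax; _×_)
open import Relation.Binary.PropositionalEquality
  using (_≡_; refl; sym; cong; cong₂)
open import Relation.Nullary.Decidable using (yes; no; does; dec-true)
open import Relation.Nullary.Negation using (¬_; contradiction)

------------------------------------------------------------------------
-- Finite simple graphs

record Graph (n : ℕ) : Set where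
  field
    adj       : Fin n → Fin n → Bool
    symmetric : ∀ i j → adj i j ≡ adj j i
    loopless  : ∀ i → adj i i ≡ false

open Graph public

_≅_ : ∀ {m n} → Graph m → Graph n → Set
_≅_ {m} {n} G H =
  Σ[ π ∈ Permutation m n ] (∀ i j → adj G i j ≡ adj H (π ⟨$⟩ʳ i) (π ⟨$⟩ʳ j))

≟-swap : ∀ {n} (i j : Fin n) → does (i ≟ j) ≡ does (j ≟ i)
≟-swap i j with i ≟ j | j ≟ i
... | yes _   | yes _   = refl
... | no  _   | no  _   = refl
... | yes i≡j | no  j≢i = contradiction (sym i≡j) j≢i
... | no  i≢j | yes j≡i = contradiction (sym j≡i) i≢j

complement : ∀ {n} → Graph n → Graph n
complement G = record
  { adj       = λ i j → not (does (i ≟ j)) ∧ not (adj G i j)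
  ; symmetric = λ i j → cong₂ (λ a b → not a ∧ not b) (≟-swap i j) (symmetric G i j)
  ; loopless  = λ i → cong (λ a → not a ∧ not (adj G i i)) (dec-true (i ≟ i) refl)
  }

-- Vertex `zero` is the vertex shared by all n triangles.  The other 2n
-- vertices are split by `quotient 2 : Fin (n * 2) → Fin n` into n pairs,
-- the k-th pair being the two unshared vertices of the k-th triangle.

friendshipAdj : ∀ n → Fin (suc (n *ℕ 2)) → Fin (suc (n *ℕ 2)) → Bool
friendshipAdj n zero    zero    = false
friendshipAdj n zero    (suc _) = true
friendshipAdj n (suc _) zero    = true
friendshipAdj n (suc i) (suc j) =
  not (does (i ≟ j)) ∧ does (quotient {n} 2 i ≟ quotient {n} 2 j)

friendship : ∀ n → Graph (suc (n *ℕ 2))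
friendship n = record
  { adj       = friendshipAdj n
  ; symmetric = symm
  ; loopless  = irr
  }
  where
  symm : ∀ i j → friendshipAdj n i j ≡ friendshipAdj n j i
  symm zero    zero    = refl
  symm zero    (suc _) = refl
  symm (suc _) zero    = refl
  symm (suc i) (suc j) =
    cong₂ (λ a b → not a ∧ b) (≟-swap i j)
          (≟-swap (quotient {n} 2 i) (quotient {n} 2 j))

  irr : ∀ i → friendshipAdj n i i ≡ false
  irr zero    = refl
  irr (suc i) =
    cong (λ a → not a ∧ does (quotient {n} 2 i ≟ quotient {n} 2 i))
         (dec-true (i ≟ i) refl)

------------------------------------------------------------------------
-- Determinants

module _ {c ℓ : Level} (R : RawRing c ℓ) where
  open RawRing R
  open RawMonoidDefs +-rawMonoid using (sum)
  open RawSemiringDefs rawSemiring using (_^_)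

  Matrix : ℕ → Set c
  Matrix n = Fin n → Fin n → Carrier

  det : ∀ {n} → Matrix n → Carrier
  det {zero}  M = 1#
  det {suc n} M = sum λ j →
    ((- 1#) ^ toℕ j) * (M zero j * det (λ i k → M (suc i) (punchIn j k)))

------------------------------------------------------------------------
-- Univariate polynomials: a₀ ∷ a₁ ∷ … stands for a₀ + a₁ X + …, and
-- trailing zero coefficients are allowed, so equality is coefficientwise.

module Polynomial {c ℓ : Level} (R : RawRing c ℓ) where
  open RawRing R

  Poly : Set c
  Poly = List Carrier

  coeff : Poly → ℕ → Carrier
  coeff []      _       = 0#
  coeff (a ∷ p) zero    = a
  coeff (a ∷ p) (suc k) = coeff p k

  _≈ₚ_ : Poly → Poly → Set ℓ
  p ≈ₚ q = ∀ k → coeff p k ≈ coeff q k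

  _+ₚ_ : Poly → Poly → Poly
  []      +ₚ q       = q
  (a ∷ p) +ₚ []      = a ∷ p
  (a ∷ p) +ₚ (b ∷ q) = (a + b) ∷ (p +ₚ q)

  -ₚ_ : Poly → Poly
  -ₚ_ = map (-_)

  _*ₚ_ : Poly → Poly → Poly
  []      *ₚ q = []
  (a ∷ p) *ₚ q = map (a *_) q +ₚ (0# ∷ (p *ₚ q))

  const : Carrier → Poly
  const a = a ∷ []

  X : Poly
  X = 0# ∷ 1# ∷ []

  polyRawRing : RawRing c ℓ
  polyRawRing = record
    { Carrier = Poly
    ; _≈_     = _≈ₚ_
    ; _+_     = _+ₚ_
    ; _*_     = _*ₚ_
    ; -_      = -ₚ_
    ; 0#      = []
    ; 1#      = const 1#
    }

  charPoly : ∀ {n} → Matrix R n → Poly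
  charPoly A = det polyRawRing λ i j →
    (if does (i ≟ j) then X else []) +ₚ (-ₚ const (A i j))

  ∏[X-_] : List Carrier → Poly
  ∏[X- as ] = foldr (λ a p → (X +ₚ (-ₚ const a)) *ₚ p) (const 1#) as

------------------------------------------------------------------------
-- Spectra.  K plays the role of the field of real numbers: it is any
-- field of characteristic zero.

module Spectrum {c ℓ₁ ℓ₂ : Level} (K : HeytingField c ℓ₁ ℓ₂) where
  open HeytingField K using (Carrier; _≈_; 0#; 1#; heytingCommutativeRing)
  open HeytingCommutativeRing heytingCommutativeRing using (commutativeRing)
  open CommutativeRing commutativeRing using (setoid; rawRing; +-rawMonoid)
  open RawMonoidDefs +-rawMonoid using () renaming (_×_ to _·_)
  open Polynomial rawRing
  open Permutationₛ setoid using (_↭_)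

  CharacteristicZero : Set ℓ₁
  CharacteristicZero = ∀ k → ¬ (suc k · 1# ≈ 0#)

  adjacencyMatrix : ∀ {n} → Graph n → Matrix rawRing n
  adjacencyMatrix G i j = if adj G i j then 1# else 0#

  -- `σ IsSpectrumOf G`: σ lists, in some order, the eigenvalues of G with
  -- their multiplicities as roots of the characteristic polynomial.  In
  -- particular all the eigenvalues of G lie in K, as is automatic over ℝ.
  _IsSpectrumOf_ : ∀ {n} → List Carrier → Graph n → Set ℓ₁
  σ IsSpectrumOf G = charPoly (adjacencyMatrix G) ≈ₚ ∏[X- σ ]

  -- Lists up to permutation, with entries compared by _≈_, are multisets.
  Cospectral : ∀ {m n} → Graph m → Graph n → Set (c ⊔ ℓ₁)
  Cospectral G H =
    ∃[ σ ] ∃[ τ ] (σ IsSpectrumOf G) × (τ IsSpectrumOf H) × (σ ↭ τ)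

module Submission where

-- The complement of Fₙ is an isolated vertex plus the cocktail party graph, with eigenvalues 2n − 2,
-- 0 and −2, so that M = A² + 2A = A (A + 2I) has rank one. Newton's identities recover the number of
-- closed walks of every length from the characteristic polynomial, so a cospectral graph H satisfies
-- the same identity (tr M²)² = tr M⁴. It is the equality case of Cauchy–Schwarz for all pairs of rows
-- of M, and thus makes all 2 × 2 minors of M vanish. Since the entries of M are the degrees and the
-- codegrees (plus 2 on edges), nonadjacent vertices of positive degree have the same neighbours: up to
-- isolated vertices H is complete multipartite. For adjacent vertices whose parts have sizes p and q
-- and which have c common neighbours, the minor gives (c + p)(c + q) = (c + 2)², hence p = q = 2 or
-- c = 0 and {p , q} = {1 , 4}. The number of edges rules out the second case for n ≥ 3, and in
-- the first one it determines the number of parts.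

open import Defs
open import Algebra.Apartness.Bundles using (HeytingCommutativeRing; HeytingField)
open import Algebra.Bundles using (CommutativeRing; CommutativeSemiring; RawRing)
import Algebra.Definitions.RawSemiring as RawSemiringDefs
import Algebra.Properties.Ring as RingProperties
import Algebra.Properties.Semiring.Sum as Sum
open import Data.Bool.Base using (Bool; true; false; if_then_else_; not; _∧_)
import Data.Bool.Properties as Bool
open import Data.Fin.Base as Fin
  using (Fin; zero; suc; toℕ; punchIn; inject₁; quotient; remainder; combine)
open import Data.Fin.Permutation using (permutation)
open import Data.Fin.Properties as Fin
  using (_≟_; any?; ¬Fin0; punchInᵢ≢i; punchOut-injective; toℕ-inject₁; <⇒notInjective;
         remQuot-combine; combine-remQuot)
open import Data.List.Base using (List; []; _∷_; foldr; length; map)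
import Data.List.Relation.Binary.Permutation.Setoid as Permutationₛ
import Data.List.Relation.Binary.Permutation.Setoid.Properties as ↭
open import Data.Nat.Base using (ℕ; _≤_)
open import Data.Nat.Base as ℕ using (zero; suc; _<_; z≤n; s≤s; z<s; s<s)
open import Data.Nat.Induction using (<-rec)
import Data.Nat.Properties as ℕ
open import Data.Nat.Solver using (module +-*-Solver)
open import Data.Product.Base using (_×_; _,_; ∃-syntax; proj₁; proj₂)
open import Data.Sum.Base using (_⊎_; inj₁; inj₂; reduce)
open import Data.Vec.Functional as Vector using (Vector; updateAt)
open import Data.Vec.Functional.Properties
  using (updateAt-updates; updateAt-minimal; updateAt-id-local; map-updateAt)
open import Function.Base using (_∘_; case_of_)
open import Function.Definitions using (Injective)
open import Level using (_⊔_)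
open import Relation.Binary.Definitions using (Tri; tri<; tri≈; tri>)
open import Relation.Binary.PropositionalEquality as ≡ using (_≡_; _≢_; refl)
open import Relation.Nullary.Decidable using (does; yes; no; dec-true; dec-false; ¬?; _×-dec_)
open import Relation.Nullary.Negation using (¬_; contradiction)

-- Matrices over a commutative semiring

-- A field of characteristic zero is all that is given, and no adjacency matrix is diagonalised over
-- it. So traces of powers are never formed as sums over eigenvalues: they are read off the
-- coefficients of the characteristic polynomial through the adjugate of XI - A, an argument valid
-- over every commutative ring. The eigenvalue lists serve to show that the two polynomials agree,
-- are monic and have a known degree. Nor does the field carry an order in which Cauchy-Schwarz
-- could be stated. The equalities of traces are therefore pulled back to the natural numbers, where
-- all later arithmetic takes place; this is why identities there avoid subtraction, and why A² +
-- 2A, with its natural entries, is convenient. The case c = 0 with parts of sizes 1 and 4 is not an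
-- artefact of the method. It is the star K_{1,4}, which for n = 2 really is cospectral with the
-- complement K_1 ∪ C_4 of F_2, so a numerical bound using n ≥ 3 has to exclude it.

module Matrices {c ℓ} (R : CommutativeSemiring c ℓ) where
  open CommutativeSemiring R hiding (zero) renaming (refl to ≈-refl)
  open import Algebra.Properties.Semiring.Sum semiring
  open import Relation.Binary.Reasoning.Setoid setoid

  sum-zero : ∀ {n} {f : Fin n → Carrier} → (∀ i → f i ≈ 0#) → sum f ≈ 0#
  sum-zero {n} f≈0 = trans (sum-cong-≋ f≈0) (sum-replicate-zero n)

  sum-single : ∀ {n} {f : Fin n → Carrier} i → (∀ {k} → k ≢ i → f k ≈ 0#) → sum f ≈ f i
  sum-single {suc n} {f} i f≈0 = trans (sum-remove {i = i} f)
    (trans (+-congˡ (sum-zero λ k → f≈0 (punchInᵢ≢i i k))) (+-identityʳ _))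

  SqMat : ℕ → Set c
  SqMat n = Fin n → Fin n → Carrier

  infix 4 _≃_
  infixl 6 _⊞_
  infixl 7 _·_

  _≃_ : ∀ {n} → SqMat n → SqMat n → Set ℓ
  A ≃ B = ∀ i j → A i j ≈ B i j

  _·_ : ∀ {n} → SqMat n → SqMat n → SqMat n
  (A · B) i j = sum λ k → A i k * B k j

  _⊞_ : ∀ {n} → SqMat n → SqMat n → SqMat n
  (A ⊞ B) i j = A i j + B i j

  _◃_ : ∀ {n} → Carrier → SqMat n → SqMat n
  (a ◃ A) i j = a * A i j

  δ : ∀ {n} → SqMat n
  δ i j = if does (i ≟ j) then 1# else 0#

  trace : ∀ {n} → SqMat n → Carrier
  trace A = sum λ i → A i i

  trace-cong : ∀ {n} {A B : SqMat n} → A ≃ B → trace A ≈ trace B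
  trace-cong A≃B = sum-cong-≋ λ i → A≃B i i

  trace-⊞ : ∀ {n} (A B : SqMat n) → trace (A ⊞ B) ≈ trace A + trace B
  trace-⊞ A B = ∑-distrib-+ (λ i → A i i) (λ i → B i i)

  trace-◃ : ∀ {n} a (A : SqMat n) → trace (a ◃ A) ≈ a * trace A
  trace-◃ a A = sym (*-distribˡ-sum a (λ i → A i i))

  ·-congˡ : ∀ {n} {A B C : SqMat n} → B ≃ C → A · B ≃ A · C
  ·-congˡ B≃C i j = sum-cong-≋ λ k → *-congˡ (B≃C k j)

  ·-distribˡ : ∀ {n} (A B C : SqMat n) → A · (B ⊞ C) ≃ A · B ⊞ A · C
  ·-distribˡ A B C i j = trans (sum-cong-≋ λ k → distribˡ (A i k) (B k j) (C k j))
    (∑-distrib-+ (λ k → A i k * B k j) (λ k → A i k * C k j))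

  ·-distribʳ : ∀ {n} (A B C : SqMat n) → (A ⊞ B) · C ≃ A · C ⊞ B · C
  ·-distribʳ A B C i j = trans (sum-cong-≋ λ k → distribʳ (C k j) (A i k) (B i k))
    (∑-distrib-+ (λ k → A i k * C k j) (λ k → B i k * C k j))

  ·-◃ : ∀ {n} a (A B : SqMat n) → A · (a ◃ B) ≃ a ◃ (A · B)
  ·-◃ a A B i j = trans (sum-cong-≋ λ k → x∙yz≈y∙xz (A i k) a (B k j))
    (sym (*-distribˡ-sum a (λ k → A i k * B k j)))
    where open import Algebra.Properties.CommutativeSemigroup *-commutativeSemigroup using (x∙yz≈y∙xz)

  ◃-· : ∀ {n} a (A B : SqMat n) → (a ◃ A) · B ≃ a ◃ (A · B)
  ◃-· a A B i j = trans (sum-cong-≋ λ k → *-assoc a (A i k) (B k j))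
    (sym (*-distribˡ-sum a (λ k → A i k * B k j)))

  ·-assoc : ∀ {n} (A B C : SqMat n) → (A · B) · C ≃ A · (B · C)
  ·-assoc A B C i j = begin
    (sum λ k → (sum λ l → A i l * B l k) * C k j)
      ≈⟨ sum-cong-≋ (λ k → *-distribʳ-sum (C k j) (λ l → A i l * B l k)) ⟩
    (sum λ k → sum λ l → A i l * B l k * C k j)
      ≈⟨ ∑-comm (λ k l → A i l * B l k * C k j) ⟩
    (sum λ l → sum λ k → A i l * B l k * C k j)
      ≈⟨ sum-cong-≋ (λ l → trans (sum-cong-≋ λ k → *-assoc (A i l) (B l k) (C k j))
                                 (sym (*-distribˡ-sum (A i l) (λ k → B l k * C k j)))) ⟩
    (sum λ l → A i l * sum λ k → B l k * C k j) ∎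

  ·-identityʳ : ∀ {n} (A : SqMat n) → A · δ ≃ A
  ·-identityʳ A i j = trans (sum-single j off) (diag j)
    where
    off : ∀ {k} → k ≢ j → A i k * δ k j ≈ 0#
    off {k} k≢j with k ≟ j
    ... | yes k≡j = contradiction k≡j k≢j
    ... | no  _   = zeroʳ _
    diag : ∀ j → A i j * δ j j ≈ A i j
    diag j with j ≟ j
    ... | yes _   = *-identityʳ _
    ... | no  j≢j = contradiction refl j≢j

  -- Left multiplication by Aᵗ. The new factor goes onto the argument, so that `act A (suc t) X` is
  -- by definition `act A t (A · X)`; the recurrences for traces rely on this unfolding.
  act : ∀ {n} → SqMat n → ℕ → SqMat n → SqMat n
  act A zero    X = X
  act A (suc t) X = act A t (A · X)

  act-cong : ∀ {n} (A : SqMat n) t {X Y} → X ≃ Y → act A t X ≃ act A t Y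
  act-cong A zero    X≃Y = X≃Y
  act-cong A (suc t) X≃Y = act-cong A t (·-congˡ {A = A} X≃Y)

  act-⊞ : ∀ {n} (A : SqMat n) t X Y → act A t (X ⊞ Y) ≃ act A t X ⊞ act A t Y
  act-⊞ A zero    X Y i j = ≈-refl
  act-⊞ A (suc t) X Y i j =
    trans (act-cong A t (·-distribˡ A X Y) i j) (act-⊞ A t (A · X) (A · Y) i j)

  act-◃ : ∀ {n} (A : SqMat n) t a X → act A t (a ◃ X) ≃ a ◃ act A t X
  act-◃ A zero    a X i j = ≈-refl
  act-◃ A (suc t) a X i j = trans (act-cong A t (·-◃ a A X) i j) (act-◃ A t a (A · X) i j)

  closedWalks : ∀ {n} → SqMat n → ℕ → Carrier
  closedWalks A t = trace (act A t δ)

-- Determinants over a commutative ring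

punchIn-inject₁ : ∀ {n} {j k : Fin n} → j Fin.≤ k → punchIn (inject₁ j) k ≡ suc k
punchIn-inject₁ {j = zero}              _         = refl
punchIn-inject₁ {j = suc j} {k = suc k} (s≤s j≤k) = ≡.cong suc (punchIn-inject₁ j≤k)

punchIn-suc : ∀ {n} {j k : Fin n} → j Fin.≤ k → punchIn (suc k) j ≡ inject₁ j
punchIn-suc {j = zero}              _         = refl
punchIn-suc {j = suc j} {k = suc k} (s≤s j≤k) = ≡.cong suc (punchIn-suc j≤k)

-- Two columns can be deleted in either order. The condition `j ≤ k` lists every unordered pair of
-- distinct columns once, as `inject₁ j` and `suc k`.
punchIn-punchIn : ∀ {n} {j k : Fin (suc n)} → j Fin.≤ k → ∀ l →
                  punchIn (inject₁ j) (punchIn k l) ≡ punchIn (suc k) (punchIn j l)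
punchIn-punchIn {j = zero}              _         l       = refl
punchIn-punchIn {j = suc j} {k = suc k} (s≤s j≤k) zero    = refl
punchIn-punchIn {j = suc j} {k = suc k} (s≤s j≤k) (suc l) = ≡.cong suc (punchIn-punchIn j≤k l)

infixl 20 _[_≔_]

_[_≔_] : ∀ {a} {A : Set a} {m} → Vector A m → Fin m → A → Vector A m
M [ r ≔ v ] = updateAt M r (λ _ → v)

module Determinant {c ℓ} (R : CommutativeRing c ℓ) where
  open CommutativeRing R hiding (zero) renaming (refl to ≈-refl)
  open import Algebra.Definitions.RawSemiring (RawRing.rawSemiring rawRing) using (_^_)
  open import Algebra.Properties.Semiring.Sum semiring
  open Matrices commutativeSemiring using (sum-zero)
  open import Algebra.Properties.Ring ring using (-‿distribˡ-*; -1*x≈-x)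
  open import Algebra.Solver.Ring.NaturalCoefficients.Default commutativeSemiring
    using (solve; _:=_; _:+_; _:*_)
  open import Relation.Binary.Reasoning.Setoid setoid

  Mat : ℕ → Set c
  Mat = Matrix rawRing

  ∣_∣ : ∀ {n} → Mat n → Carrier
  ∣_∣ = det rawRing

  minor : ∀ {n} → Mat (suc n) → Fin (suc n) → Mat n
  minor M j i k = M (suc i) (punchIn j k)

  sign : ∀ {n} → Fin n → Carrier
  sign j = (- 1#) ^ toℕ j

  **-distribˡ-sum : ∀ {n} x y (f : Fin n → Carrier) → x * (y * sum f) ≈ sum λ k → x * (y * f k)
  **-distribˡ-sum x y f = trans (*-congˡ (*-distribˡ-sum y f)) (*-distribˡ-sum x (λ k → y * f k))

  det-cong : ∀ {n} {M N : Mat n} → (∀ i j → M i j ≈ N i j) → ∣ M ∣ ≈ ∣ N ∣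
  det-cong {zero}  M≈N = ≈-refl
  det-cong {suc n} M≈N = sum-cong-≋ λ j → *-congˡ {x = sign j}
    (*-cong (M≈N zero j) (det-cong λ i k → M≈N (suc i) (punchIn j k)))

  []≔-cong : ∀ {m n} (M : Fin m → Fin n → Carrier) r {u v} → (∀ j → u j ≈ v j) →
             ∀ i j → (M [ r ≔ u ]) i j ≈ (M [ r ≔ v ]) i j
  []≔-cong M zero    u≈v zero    j = u≈v j
  []≔-cong M zero    u≈v (suc i) j = ≈-refl
  []≔-cong M (suc r) u≈v zero    j = ≈-refl
  []≔-cong M (suc r) u≈v (suc i) j = []≔-cong (M ∘ suc) r u≈v i j

  det-[suc]≔ : ∀ {n} (M : Mat (suc n)) r v →
    ∣ M [ suc r ≔ v ] ∣ ≈ sum λ j → sign j * (M zero j * ∣ minor M j [ r ≔ v ∘ punchIn j ] ∣)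
  det-[suc]≔ M r v = sum-cong-≋ λ j → *-congˡ {x = sign j} (*-congˡ {x = M zero j}
    (det-cong λ i k → reflexive (≡.cong-app
      (map-updateAt {f = _∘ punchIn j} {g = λ _ → v} {h = λ _ → v ∘ punchIn j} (λ _ → refl) (M ∘ suc) r i) k)))

  -- The number `l` of summands is independent of the size of the matrix: a full family of unit rows
  -- gives Cramer's rule, and `l = 1` pulls a scalar out of a row.
  det-linear : ∀ {l n} (M : Mat n) r (a : Fin l → Carrier) (v : Fin l → Fin n → Carrier) →
    ∣ M [ r ≔ (λ k → sum λ j → a j * v j k) ] ∣ ≈ sum λ j → a j * ∣ M [ r ≔ v j ] ∣
  det-linear M zero a v = begin
    sum (λ k → sign k * (sum (λ j → a j * v j k) * ∣ minor M k ∣))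
      ≈⟨ sum-cong-≋ (λ k → trans (*-congˡ {x = sign k} (*-distribʳ-sum ∣ minor M k ∣ (λ j → a j * v j k)))
                                 (*-distribˡ-sum (sign k) (λ j → a j * v j k * ∣ minor M k ∣))) ⟩
    sum (λ k → sum λ j → sign k * (a j * v j k * ∣ minor M k ∣))
      ≈⟨ ∑-comm (λ k j → sign k * (a j * v j k * ∣ minor M k ∣)) ⟩
    sum (λ j → sum λ k → sign k * (a j * v j k * ∣ minor M k ∣))
      ≈⟨ sum-cong-≋ (λ j → trans
           (sum-cong-≋ λ k → solve 4 (λ s x y d → s :* (x :* y :* d) := x :* (s :* (y :* d))) ≈-refl
                               (sign k) (a j) (v j k) ∣ minor M k ∣)
           (sym (*-distribˡ-sum (a j) (λ k → sign k * (v j k * ∣ minor M k ∣))))) ⟩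
    sum (λ j → a j * ∣ M [ zero ≔ v j ] ∣) ∎
  det-linear M (suc r) a v = begin
    ∣ M [ suc r ≔ (λ k → sum λ j → a j * v j k) ] ∣
      ≈⟨ det-[suc]≔ M r _ ⟩
    sum (λ k → sign k * (M zero k * ∣ minor M k [ r ≔ (λ i → sum λ j → a j * v j (punchIn k i)) ] ∣))
      ≈⟨ sum-cong-≋ (λ k → *-congˡ {x = sign k} (*-congˡ {x = M zero k}
           (det-linear (minor M k) r a (λ j → v j ∘ punchIn k)))) ⟩
    sum (λ k → sign k * (M zero k * sum (λ j → a j * D j k)))
      ≈⟨ sum-cong-≋ (λ k → **-distribˡ-sum (sign k) (M zero k) (λ j → a j * D j k)) ⟩
    sum (λ k → sum λ j → sign k * (M zero k * (a j * D j k)))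
      ≈⟨ ∑-comm (λ k j → sign k * (M zero k * (a j * D j k))) ⟩
    sum (λ j → sum λ k → sign k * (M zero k * (a j * D j k)))
      ≈⟨ sum-cong-≋ (λ j → trans
           (sum-cong-≋ λ k → solve 4 (λ s y x d → s :* (y :* (x :* d)) := x :* (s :* (y :* d))) ≈-refl
                               (sign k) (M zero k) (a j) (D j k))
           (sym (*-distribˡ-sum (a j) (λ k → sign k * (M zero k * D j k))))) ⟩
    sum (λ j → a j * sum λ k → sign k * (M zero k * D j k))
      ≈⟨ sum-cong-≋ (λ j → *-congˡ {x = a j} (det-[suc]≔ M r (v j))) ⟨
    sum (λ j → a j * ∣ M [ suc r ≔ v j ] ∣) ∎
    where
    D : Fin _ → Fin _ → Carrier
    D j k = ∣ minor M k [ r ≔ v j ∘ punchIn k ] ∣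

  -- The pairs (j , punchIn j k) with j ≤ k, respectively j > k, are matched with their transposes.
  sum-transpositions : ∀ {n} (F : Fin (suc n) → Fin n → Carrier) →
    (∀ {j k} → j Fin.≤ k → F (inject₁ j) k + F (suc k) j ≈ 0#) → (sum λ j → sum (F j)) ≈ 0#
  sum-transpositions {zero}  F h = +-identityʳ 0#
  sum-transpositions {suc n} F h = begin
    sum (F zero) + sum (λ j → F (suc j) zero + sum (λ k → F (suc j) (suc k)))
      ≈⟨ +-congˡ (∑-distrib-+ (λ j → F (suc j) zero) (λ j → sum (λ k → F (suc j) (suc k)))) ⟩
    sum (F zero) + (sum (λ j → F (suc j) zero) + sum (λ j → sum (λ k → F (suc j) (suc k))))
      ≈⟨ +-assoc _ _ _ ⟨
    sum (F zero) + sum (λ j → F (suc j) zero) + sum (λ j → sum (λ k → F (suc j) (suc k)))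
      ≈⟨ +-cong (trans (sym (∑-distrib-+ (F zero) (λ j → F (suc j) zero))) (sum-zero λ k → h {zero} {k} z≤n))
                (sum-transpositions (λ j k → F (suc j) (suc k)) (h ∘ s≤s)) ⟩
    0# + 0#
      ≈⟨ +-identityʳ 0# ⟩
    0# ∎

  -- The sum is the determinant of `N` with a second copy of row `i` put on top. For `i = zero` a
  -- double expansion along the two equal rows cancels in transposed pairs. Otherwise the two top
  -- rows are exchanged: the exchanged double sum vanishes by induction, and added to the original
  -- it again cancels in transposed pairs.
  cofactors-orthogonal : ∀ {n} (N : Fin n → Fin (suc n) → Carrier) i →
    (sum λ j → sign j * (N i j * ∣ (λ a k → N a (punchIn j k)) ∣)) ≈ 0#
  cofactors-orthogonal {suc n} N = λ where
      zero    → trans (expand zero)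
                      (sum-transpositions (term zero zero) (transposed zero zero))
      (suc i) → begin
        sum (λ j → sign j * (N (suc i) j * ∣ (λ a k → N a (punchIn j k)) ∣))
          ≈⟨ expand (suc i) ⟩
        double (suc i) zero
          ≈⟨ +-identityʳ _ ⟨
        double (suc i) zero + 0#
          ≈⟨ +-congˡ (swapped i) ⟨
        double (suc i) zero + double zero (suc i)
          ≈⟨ trans (sum-cong-≋ λ j → ∑-distrib-+ (term (suc i) zero j) (term zero (suc i) j))
                   (∑-distrib-+ (sum ∘ term (suc i) zero) (sum ∘ term zero (suc i))) ⟨
        sum (λ j → sum λ k → term (suc i) zero j k + term zero (suc i) j k)
          ≈⟨ sum-transpositions (λ j k → term (suc i) zero j k + term zero (suc i) j k) (both i) ⟩
        0# ∎
    where
    D : Fin (suc (suc n)) → Fin (suc n) → Carrier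
    D j k = ∣ (λ a l → N (suc a) (punchIn j (punchIn k l))) ∣

    term : Fin (suc n) → Fin (suc n) → Fin (suc (suc n)) → Fin (suc n) → Carrier
    term u v j k = sign j * (N u j * (sign k * (N v (punchIn j k) * D j k)))

    double : Fin (suc n) → Fin (suc n) → Carrier
    double u v = sum λ j → sum (term u v j)

    expand : ∀ u → (sum λ j → sign j * (N u j * ∣ (λ a k → N a (punchIn j k)) ∣)) ≈ double u zero
    expand u = sum-cong-≋ λ j → **-distribˡ-sum (sign j) (N u j) (λ k → sign k * (N zero (punchIn j k) * D j k))

    swapped : ∀ i → double zero (suc i) ≈ 0#
    swapped i = sum-zero λ j → trans
      (sym (**-distribˡ-sum (sign j) (N zero j) (λ k → sign k * (N (suc i) (punchIn j k) * D j k))))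
      (trans (*-congˡ {x = sign j} (trans (*-congˡ {x = N zero j}
                (cofactors-orthogonal (λ a k → N (suc a) (punchIn j k)) i)) (zeroʳ _)))
             (zeroʳ _))

    transposed : ∀ u v {j k} → j Fin.≤ k → term u v (inject₁ j) k + term v u (suc k) j ≈ 0#
    transposed u v {j} {k} j≤k = begin
      term u v (inject₁ j) k + term v u (suc k) j
        ≈⟨ +-cong
             (*-cong (reflexive (≡.cong (λ t → (- 1#) ^ t) (toℕ-inject₁ j)))
               (*-congˡ {x = x} (*-congˡ {x = sign k} (*-cong
                  (reflexive (≡.cong (N v) (punchIn-inject₁ j≤k)))
                  (det-cong λ a l → reflexive (≡.cong (N (suc a)) (punchIn-punchIn j≤k l)))))))
             (*-cong (-1*x≈-x (sign k)) (*-congˡ {x = y} (*-congˡ {x = sign j} (*-congʳ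
                  (reflexive (≡.cong (N u) (punchIn-suc j≤k))))))) ⟩
      sign j * (x * (sign k * (y * d))) + - sign k * (y * (sign j * (x * d)))
        ≈⟨ +-congˡ (-‿distribˡ-* _ _) ⟨
      sign j * (x * (sign k * (y * d))) + - (sign k * (y * (sign j * (x * d))))
        ≈⟨ +-congʳ (solve 5 (λ s t x y d → s :* (x :* (t :* (y :* d))) := t :* (y :* (s :* (x :* d)))) ≈-refl
                      (sign j) (sign k) x y d) ⟩
      sign k * (y * (sign j * (x * d))) + - (sign k * (y * (sign j * (x * d))))
        ≈⟨ -‿inverseʳ _ ⟩
      0# ∎
      where
      x = N u (inject₁ j)
      y = N v (suc k)
      d = D (suc k) j

    both : ∀ i {j k} → j Fin.≤ k →
      (term (suc i) zero (inject₁ j) k + term zero (suc i) (inject₁ j) k) +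
      (term (suc i) zero (suc k) j + term zero (suc i) (suc k) j) ≈ 0#
    both i j≤k = trans
      (solve 4 (λ a b c d → (a :+ b) :+ (c :+ d) := (a :+ d) :+ (b :+ c)) ≈-refl _ _ _ _)
      (trans (+-cong (transposed (suc i) zero j≤k) (transposed zero (suc i) j≤k)) (+-identityʳ 0#))

  det-equalRows : ∀ {n} (M : Mat n) {i k} → i ≢ k → (∀ l → M i l ≈ M k l) → ∣ M ∣ ≈ 0#
  det-equalRows M {zero}  {zero}  i≢k eq = contradiction refl i≢k
  det-equalRows M {zero}  {suc k} i≢k eq = trans
    (sum-cong-≋ λ j → *-congˡ {x = sign j} (*-congʳ {x = ∣ minor M j ∣} (eq j)))
    (cofactors-orthogonal (M ∘ suc) k)
  det-equalRows M {suc i} {zero}  i≢k eq =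
    det-equalRows M {zero} {suc i} (i≢k ∘ ≡.sym) (sym ∘ eq)
  det-equalRows M {suc i} {suc k} i≢k eq = sum-zero λ j → trans
    (*-congˡ {x = sign j} (trans (*-congˡ {x = M zero j}
      (det-equalRows (minor M j) (i≢k ∘ ≡.cong suc) (eq ∘ punchIn j))) (zeroʳ _)))
    (zeroʳ _)

  -- Derivations applied to determinants.

  module Derivation
    (∂ : Carrier → Carrier)
    (∂-cong : ∀ {x y} → x ≈ y → ∂ x ≈ ∂ y)
    (∂-+ : ∀ x y → ∂ (x + y) ≈ ∂ x + ∂ y)
    (∂-* : ∀ x y → ∂ (x * y) ≈ ∂ x * y + x * ∂ y)
    (∂-0 : ∂ 0# ≈ 0#) (∂-1 : ∂ 1# ≈ 0#) (∂-neg1 : ∂ (- 1#) ≈ 0#)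
    where

    ∂-sum : ∀ {n} (f : Fin n → Carrier) → ∂ (sum f) ≈ sum (∂ ∘ f)
    ∂-sum {zero}  f = ∂-0
    ∂-sum {suc n} f = trans (∂-+ _ _) (+-congˡ (∂-sum (f ∘ suc)))

    ∂-constant* : ∀ {s} x → ∂ s ≈ 0# → ∂ (s * x) ≈ s * ∂ x
    ∂-constant* {s} x ∂s≈0 = trans (∂-* s x)
      (trans (+-congʳ (trans (*-congʳ ∂s≈0) (zeroˡ x))) (+-identityˡ _))

    ∂-sign : ∀ {n} (j : Fin n) → ∂ (sign j) ≈ 0#
    ∂-sign zero    = ∂-1
    ∂-sign (suc j) = trans (∂-constant* (sign j) ∂-neg1) (trans (*-congˡ (∂-sign j)) (zeroʳ _))

    -- The Leibniz rule, one row at a time. With the Euler operator for `∂` and XI - A for `M` this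
    -- becomes Jacobi's formula.
    ∂-det : ∀ {n} (M : Mat n) → ∂ ∣ M ∣ ≈ sum λ r → ∣ M [ r ≔ ∂ ∘ M r ] ∣
    ∂-det {zero}  M = ∂-1
    ∂-det {suc n} M = begin
      ∂ (sum λ j → sign j * (M zero j * ∣ minor M j ∣))
        ≈⟨ ∂-sum (λ j → sign j * (M zero j * ∣ minor M j ∣)) ⟩
      sum (λ j → ∂ (sign j * (M zero j * ∣ minor M j ∣)))
        ≈⟨ sum-cong-≋ (λ j → trans (∂-constant* _ (∂-sign j))
             (trans (*-congˡ {x = sign j} (∂-* (M zero j) ∣ minor M j ∣)) (distribˡ _ _ _))) ⟩
      sum (λ j → sign j * (∂ (M zero j) * ∣ minor M j ∣) + sign j * (M zero j * ∂ ∣ minor M j ∣))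
        ≈⟨ ∑-distrib-+ (λ j → sign j * (∂ (M zero j) * ∣ minor M j ∣))
                         (λ j → sign j * (M zero j * ∂ ∣ minor M j ∣)) ⟩
      ∣ M [ zero ≔ ∂ ∘ M zero ] ∣ + sum (λ j → sign j * (M zero j * ∂ ∣ minor M j ∣))
        ≈⟨ +-congˡ rest ⟩
      ∣ M [ zero ≔ ∂ ∘ M zero ] ∣ + sum (λ r → ∣ M [ suc r ≔ ∂ ∘ M (suc r) ] ∣) ∎
      where
      D : Fin n → Fin (suc n) → Carrier
      D r j = ∣ minor M j [ r ≔ ∂ ∘ minor M j r ] ∣

      rest : (sum λ j → sign j * (M zero j * ∂ ∣ minor M j ∣)) ≈
             (sum λ r → ∣ M [ suc r ≔ ∂ ∘ M (suc r) ] ∣)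
      rest = begin
        sum (λ j → sign j * (M zero j * ∂ ∣ minor M j ∣))
          ≈⟨ sum-cong-≋ (λ j → trans
               (*-congˡ {x = sign j} (*-congˡ {x = M zero j} (∂-det (minor M j))))
               (**-distribˡ-sum (sign j) (M zero j) (λ r → D r j))) ⟩
        sum (λ j → sum λ r → sign j * (M zero j * D r j))
          ≈⟨ ∑-comm (λ j r → sign j * (M zero j * D r j)) ⟩
        sum (λ r → sum λ j → sign j * (M zero j * D r j))
          ≈⟨ sum-cong-≋ (λ r → det-[suc]≔ M r (∂ ∘ M (suc r))) ⟨
        sum (λ r → ∣ M [ suc r ≔ ∂ ∘ M (suc r) ] ∣) ∎

-- Power series and the coefficients of polynomials

module PowerSeries {c ℓ} (R : CommutativeRing c ℓ) where
  open CommutativeRing R hiding (zero) renaming (refl to ≈-refl)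
  open import Algebra.Definitions.RawMonoid (RawRing.+-rawMonoid rawRing) using () renaming (_×_ to _•_)
  open import Algebra.Properties.Monoid.Mult +-monoid using (×-congʳ)
  open import Algebra.Properties.CommutativeMonoid.Mult +-commutativeMonoid using (×-distrib-+)
  open import Algebra.Properties.Semiring.Mult semiring using (×-comm-*)
  open import Algebra.Properties.Ring ring using (-0#≈0#)
  open import Algebra.Solver.Ring.NaturalCoefficients.Default commutativeSemiring
    using (solve; _:=_; _:+_; _:*_)
  open import Relation.Binary.Reasoning.Setoid setoid
  open Polynomial rawRing

  -- List polynomials are compared only through their coefficients. The ring laws are therefore
  -- proved for coefficient functions, and `coeff` carries sums, products and determinants of
  -- polynomials over to them.
  Series : Set c
  Series = ℕ → Carrier

  infix 4 _≋_
  infixl 7 _⊛_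
  infixl 6 _⊕_

  _≋_ : Series → Series → Set ℓ
  f ≋ g = ∀ k → f k ≈ g k

  _⊕_ : Series → Series → Series
  (f ⊕ g) k = f k + g k

  ⊖_ : Series → Series
  (⊖ f) k = - f k

  𝟘 : Series
  𝟘 _ = 0#

  𝟙 : Series
  𝟙 zero    = 1#
  𝟙 (suc _) = 0#

  _⊛_ : Series → Series → Series
  (f ⊛ g) zero    = f 0 * g 0
  (f ⊛ g) (suc k) = f 0 * g (suc k) + (f ∘ suc ⊛ g) k

  ⊛-cong : ∀ {f f′ g g′} → f ≋ f′ → g ≋ g′ → f ⊛ g ≋ f′ ⊛ g′
  ⊛-cong p q zero    = *-cong (p 0) (q 0)
  ⊛-cong p q (suc k) = +-cong (*-cong (p 0) (q (suc k))) (⊛-cong (p ∘ suc) q k)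

  ⊛-zeroˡ : ∀ g → 𝟘 ⊛ g ≋ 𝟘
  ⊛-zeroˡ g zero    = zeroˡ _
  ⊛-zeroˡ g (suc k) = trans (+-cong (zeroˡ _) (⊛-zeroˡ g k)) (+-identityʳ 0#)

  ⊛-sucʳ : ∀ f g k → (f ⊛ g) (suc k) ≈ f (suc k) * g 0 + (f ⊛ g ∘ suc) k
  ⊛-sucʳ f g zero    = +-comm _ _
  ⊛-sucʳ f g (suc k) = trans (+-congˡ (⊛-sucʳ (f ∘ suc) g k))
    (solve 3 (λ a b c → a :+ (b :+ c) := b :+ (a :+ c)) ≈-refl _ _ _)

  ⊛-comm : ∀ f g → f ⊛ g ≋ g ⊛ f
  ⊛-comm f g zero    = *-comm _ _
  ⊛-comm f g (suc k) = trans (+-cong (*-comm _ _) (⊛-comm (f ∘ suc) g k)) (sym (⊛-sucʳ g f k))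

  ⊛-distribʳ : ∀ h f g → (f ⊕ g) ⊛ h ≋ f ⊛ h ⊕ g ⊛ h
  ⊛-distribʳ h f g zero    = distribʳ _ _ _
  ⊛-distribʳ h f g (suc k) = trans
    (+-cong (distribʳ _ _ _) (⊛-distribʳ h (f ∘ suc) (g ∘ suc) k))
    (solve 4 (λ a b c d → (a :+ b) :+ (c :+ d) := (a :+ c) :+ (b :+ d)) ≈-refl _ _ _ _)

  scale : Carrier → Series → Series
  scale a f k = a * f k

  ⊛-scaleˡ : ∀ a f g → scale a f ⊛ g ≋ scale a (f ⊛ g)
  ⊛-scaleˡ a f g zero    = *-assoc _ _ _
  ⊛-scaleˡ a f g (suc k) = trans (+-cong (*-assoc _ _ _) (⊛-scaleˡ a (f ∘ suc) g k)) (sym (distribˡ _ _ _))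

  ⊛-assoc : ∀ f g h → (f ⊛ g) ⊛ h ≋ f ⊛ (g ⊛ h)
  ⊛-assoc f g h zero    = *-assoc _ _ _
  ⊛-assoc f g h (suc k) = begin
    f 0 * g 0 * h (suc k) + (((scale (f 0) (g ∘ suc)) ⊕ (f ∘ suc ⊛ g)) ⊛ h) k
      ≈⟨ +-cong (*-assoc _ _ _) (trans (⊛-distribʳ h (scale (f 0) (g ∘ suc)) (f ∘ suc ⊛ g) k)
           (+-cong (⊛-scaleˡ (f 0) (g ∘ suc) h k) (⊛-assoc (f ∘ suc) g h k))) ⟩
    f 0 * (g 0 * h (suc k)) + (f 0 * (g ∘ suc ⊛ h) k + (f ∘ suc ⊛ (g ⊛ h)) k)
      ≈⟨ solve 4 (λ a x y z → a :* x :+ (a :* y :+ z) := a :* (x :+ y) :+ z) ≈-refl _ _ _ _ ⟩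
    f 0 * (g 0 * h (suc k) + (g ∘ suc ⊛ h) k) + (f ∘ suc ⊛ (g ⊛ h)) k ∎

  ⊛-identityˡ : ∀ f → 𝟙 ⊛ f ≋ f
  ⊛-identityˡ f zero    = *-identityˡ _
  ⊛-identityˡ f (suc k) = trans (+-cong (*-identityˡ _) (⊛-zeroˡ f k)) (+-identityʳ _)

  seriesRing : CommutativeRing c ℓ
  seriesRing = record
    { Carrier = Series
    ; _≈_ = _≋_ ; _+_ = _⊕_ ; _*_ = _⊛_ ; -_ = ⊖_ ; 0# = 𝟘 ; 1# = 𝟙
    ; isCommutativeRing = record
      { isRing = record
        { +-isAbelianGroup = record
          { isGroup = record
            { isMonoid = record
              { isSemigroup = record
                { isMagma = record
                  { isEquivalence = record
                    { refl  = λ k → ≈-refl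
                    ; sym   = λ p k → sym (p k)
                    ; trans = λ p q k → trans (p k) (q k)
                    }
                  ; ∙-cong = λ p q k → +-cong (p k) (q k)
                  }
                ; assoc = λ f g h k → +-assoc _ _ _
                }
              ; identity = (λ f k → +-identityˡ _) , (λ f k → +-identityʳ _)
              }
            ; inverse = (λ f k → -‿inverseˡ _) , (λ f k → -‿inverseʳ _)
            ; ⁻¹-cong = λ p k → -‿cong (p k)
            }
          ; comm = λ f g k → +-comm _ _
          }
        ; *-cong = ⊛-cong
        ; *-assoc = ⊛-assoc
        ; *-identity = ⊛-identityˡ , λ f k → trans (⊛-comm f 𝟙 k) (⊛-identityˡ f k)
        ; distrib = (λ h f g k → trans (⊛-comm h (f ⊕ g) k)
                       (trans (⊛-distribʳ h f g k) (+-cong (⊛-comm f h k) (⊛-comm g h k))))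
                  , ⊛-distribʳ
        }
      ; *-comm = ⊛-comm
      }
    }

  -- The Euler operator x·d/dx.
  θ : Series → Series
  θ f k = k • f k

  θ-cong : ∀ {f g} → f ≋ g → θ f ≋ θ g
  θ-cong f≋g k = ×-congʳ k (f≋g k)

  θ-⊕ : ∀ f g → θ (f ⊕ g) ≋ θ f ⊕ θ g
  θ-⊕ f g k = ×-distrib-+ (f k) (g k) k

  θ-⊛ : ∀ f g → θ (f ⊛ g) ≋ θ f ⊛ g ⊕ f ⊛ θ g
  θ-⊛ f g zero    = sym (trans (+-cong (zeroˡ _) (zeroʳ _)) (+-identityʳ 0#))
  θ-⊛ f g (suc k) = begin
    (a + b) + k • (a + b)
      ≈⟨ +-congˡ (trans (×-distrib-+ a b k) (+-congˡ (θ-⊛ (f ∘ suc) g k))) ⟩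
    (a + b) + (k • a + (θf′g + f′θg))
      ≈⟨ solve 5 (λ a b c d e → (a :+ b) :+ (c :+ (d :+ e)) := (b :+ d) :+ ((a :+ c) :+ e)) ≈-refl
           a b (k • a) θf′g f′θg ⟩
    (b + θf′g) + ((a + k • a) + f′θg)
      ≈⟨ +-cong (trans (+-congʳ (zeroˡ _)) (trans (+-identityˡ _) (⊛-distribʳ g (f ∘ suc) (θ (f ∘ suc)) k)))
                (+-congʳ (×-comm-* (suc k) (f 0) (g (suc k)))) ⟨
    (θ f ⊛ g ⊕ f ⊛ θ g) (suc k) ∎
    where
    a = f 0 * g (suc k)
    b = (f ∘ suc ⊛ g) k
    θf′g = (θ (f ∘ suc) ⊛ g) k
    f′θg = (f ∘ suc ⊛ θ g) k

  ×0≈0 : ∀ {x} k → x ≈ 0# → k • x ≈ 0#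
  ×0≈0 zero    x≈0 = ≈-refl
  ×0≈0 (suc k) x≈0 = trans (+-cong x≈0 (×0≈0 k x≈0)) (+-identityʳ 0#)

  θ-constant : ∀ {f} → (∀ k → f (suc k) ≈ 0#) → θ f ≋ 𝟘
  θ-constant f≈0 zero    = ≈-refl
  θ-constant f≈0 (suc k) = ×0≈0 (suc k) (f≈0 k)

  coeff-+ : ∀ p q → coeff (p +ₚ q) ≋ coeff p ⊕ coeff q
  coeff-+ []      q       k       = sym (+-identityˡ _)
  coeff-+ (a ∷ p) []      k       = sym (+-identityʳ _)
  coeff-+ (a ∷ p) (b ∷ q) zero    = ≈-refl
  coeff-+ (a ∷ p) (b ∷ q) (suc k) = coeff-+ p q k

  coeff-neg : ∀ p → coeff (-ₚ p) ≋ ⊖ coeff p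
  coeff-neg []      k       = sym -0#≈0#
  coeff-neg (a ∷ p) zero    = ≈-refl
  coeff-neg (a ∷ p) (suc k) = coeff-neg p k

  coeff-map* : ∀ a p → coeff (map (a *_) p) ≋ scale a (coeff p)
  coeff-map* a []      k       = sym (zeroʳ a)
  coeff-map* a (b ∷ p) zero    = ≈-refl
  coeff-map* a (b ∷ p) (suc k) = coeff-map* a p k

  coeff-* : ∀ p q → coeff (p *ₚ q) ≋ coeff p ⊛ coeff q
  coeff-* []      q k       = sym (⊛-zeroˡ (coeff q) k)
  coeff-* (a ∷ p) q zero    = trans (coeff-+ (map (a *_) q) (0# ∷ (p *ₚ q)) 0)
    (trans (+-identityʳ _) (coeff-map* a q 0))
  coeff-* (a ∷ p) q (suc k) = trans (coeff-+ (map (a *_) q) (0# ∷ (p *ₚ q)) (suc k))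
    (+-cong (coeff-map* a q (suc k)) (coeff-* p q k))

  coeff-1 : coeff (const 1#) ≋ 𝟙
  coeff-1 zero    = ≈-refl
  coeff-1 (suc k) = ≈-refl

  coeff-beyond : ∀ p {k} → length p ℕ.≤ k → coeff p k ≈ 0#
  coeff-beyond []      _         = ≈-refl
  coeff-beyond (a ∷ p) (s≤s l≤k) = coeff-beyond p l≤k

  module S = CommutativeRing seriesRing
  module P = RawSemiringDefs (RawRing.rawSemiring polyRawRing)
  module Sᵈ = RawSemiringDefs (RawRing.rawSemiring S.rawRing)

  coeff-sum : ∀ {n} (f : Fin n → Poly) → coeff (P.sum f) ≋ Sᵈ.sum (coeff ∘ f)
  coeff-sum {zero}  f k = ≈-refl
  coeff-sum {suc n} f k = trans (coeff-+ (f zero) _ k) (+-congˡ (coeff-sum (f ∘ suc) k))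

  coeff-sign : ∀ k → coeff ((-ₚ const 1#) P.^ k) ≋ (⊖ 𝟙) Sᵈ.^ k
  coeff-sign zero    = coeff-1
  coeff-sign (suc k) = S.trans {coeff ((-ₚ const 1#) P.^ suc k)} (coeff-* (-ₚ const 1#) ((-ₚ const 1#) P.^ k))
    (⊛-cong (S.trans {coeff (-ₚ const 1#)} (coeff-neg (const 1#)) (S.-‿cong coeff-1)) (coeff-sign k))

  coeff-det : ∀ {n} (M : Matrix polyRawRing n) → coeff (det polyRawRing M) ≋ det S.rawRing (λ i j → coeff (M i j))
  coeff-det {zero}  M = coeff-1
  coeff-det {suc n} M = S.trans {coeff (det polyRawRing M)}
    (coeff-sum (λ j → ((-ₚ const 1#) P.^ toℕ j) *ₚ (M zero j *ₚ D j)))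
    (sum-cong-≋ λ j → S.trans {coeff (((-ₚ const 1#) P.^ toℕ j) *ₚ (M zero j *ₚ D j))}
       (coeff-* ((-ₚ const 1#) P.^ toℕ j) (M zero j *ₚ D j))
       (⊛-cong (coeff-sign (toℕ j)) (S.trans {coeff (M zero j *ₚ D j)} (coeff-* (M zero j) (D j))
          (⊛-cong (λ _ → ≈-refl) (coeff-det (λ i k → M (suc i) (punchIn j k)))))))
    where
    open import Algebra.Properties.Semiring.Sum S.semiring using (sum-cong-≋)
    D : Fin (suc n) → Poly
    D j = det polyRawRing (λ i k → M (suc i) (punchIn j k))

-- Newton's identities

common-bound : ∀ {p n} (P : Fin n → ℕ → Set p) → (∀ i → ∃[ b ] (∀ {k} → b ℕ.≤ k → P i k)) →
               ∃[ b ] (∀ i {k} → b ℕ.≤ k → P i k)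
common-bound {n = zero}  P h = 0 , λ ()
common-bound {n = suc n} P h with h zero | common-bound (P ∘ suc) (h ∘ suc)
... | b , P₀ | b′ , Pₛ = b ℕ.⊔ b′ , λ where
  zero    b≤k → P₀ (ℕ.m⊔n≤o⇒m≤o b b′ b≤k)
  (suc i) b≤k → Pₛ i (ℕ.m⊔n≤o⇒n≤o b b′ b≤k)

module CharacteristicPolynomial {c ℓ} (R : CommutativeRing c ℓ) where
  open CommutativeRing R hiding (zero) renaming (refl to ≈-refl)
  open import Algebra.Definitions.RawMonoid (RawRing.+-rawMonoid rawRing) using () renaming (_×_ to _•_)
  open import Algebra.Properties.Semiring.Sum semiring
  open import Algebra.Properties.Ring ring using (-0#≈0#)
  open import Algebra.Properties.AbelianGroup +-abelianGroup using (⁻¹-∙-comm; ∙-cancelʳ)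
  open import Algebra.Properties.Monoid.Mult +-monoid using (×-congʳ)
  open import Relation.Binary.Reasoning.Setoid setoid
  open Polynomial rawRing
  open PowerSeries R
  open Matrices commutativeSemiring
  private
    module SM = Matrices S.commutativeSemiring
    module SΣ = Sum S.semiring
    module SR = RingProperties S.ring
  module SD = Determinant seriesRing

  shift : Series → Series
  shift f zero    = 0#
  shift f (suc k) = f k

  const-⊛ : ∀ a w → coeff (const a) ⊛ w ≋ scale a w
  const-⊛ a w zero    = ≈-refl
  const-⊛ a w (suc k) = trans (+-congˡ (⊛-zeroˡ w k)) (+-identityʳ _)

  X-⊛ : ∀ w → coeff X ⊛ w ≋ shift w
  X-⊛ w zero    = zeroˡ _
  X-⊛ w (suc k) = trans (+-cong (zeroˡ _) (trans (const-⊛ 1# w k) (*-identityˡ _))) (+-identityˡ _)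

  sum-at : ∀ {n} (f : Fin n → Series) k → SΣ.sum f k ≈ sum (λ i → f i k)
  sum-at {zero}  f k = ≈-refl
  sum-at {suc n} f k = +-congˡ (sum-at (f ∘ suc) k)

  sum-neg : ∀ {n} (f : Fin n → Carrier) → sum (λ i → - f i) ≈ - sum f
  sum-neg {zero}  f = sym -0#≈0#
  sum-neg {suc n} f = trans (+-congˡ (sum-neg (f ∘ suc))) (⁻¹-∙-comm _ _)

  -- V s is the coefficient of Xˢ in X · adj (X I − A), so that V s = A V (s + 1) + p s I
  -- and V 0 = 0, while Jacobi's formula for the derivative of p gives trace (V s) = s · p s.
  -- Hence τ t s = trace (Aᵗ V s) ties the power sums of the eigenvalues of A to the coefficients of p.
  record NewtonIdentities (p : Series) (w : ℕ → Carrier) : Set (c ⊔ ℓ) where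
    field
      τ      : ℕ → ℕ → Carrier
      τ-suc  : ∀ t s → τ t s ≈ τ (suc t) (suc s) + p s * w t
      τ-zero : ∀ s → τ 0 s ≈ s • p s
      τ-0    : ∀ t → τ t 0 ≈ 0#
      τ-top  : ∀ {N} → (∀ {s} → N ℕ.< s → p s ≈ 0#) → p N ≈ 1# → ∀ t → τ t N ≈ w t

  module _ {m} (A : SqMat m) where
    L : Fin m → Fin m → Poly
    L i j = (if does (i ≟ j) then X else []) +ₚ (-ₚ const (A i j))

    unit : Fin m → Fin m → Poly
    unit k l = if does (k ≟ l) then const 1# else []

    M E : Fin m → Fin m → Series
    M i j = coeff (L i j)
    E i j = coeff (unit i j)

    p : Series
    p = coeff (charPoly A)

    -- The cofactor of XI - A at (i , k), which is the entry (k , i) of the adjugate.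
    W : Fin m → Fin m → Series
    W i k = SD.∣ M [ i ≔ E k ] ∣

    -- The same determinant taken over list polynomials is a finite list, whose length is the bound.
    -- Any bound will do, since it only starts the downward induction in `V-beyond`.
    W-beyond : ∀ i k → ∃[ b ] (∀ {s} → b ℕ.≤ s → W i k s ≈ 0#)
    W-beyond i k = length P , λ b≤s → trans (sym (P-W _)) (coeff-beyond P b≤s)
      where
      P : Poly
      P = det polyRawRing (L [ i ≔ unit k ])
      P-W : coeff P ≋ W i k
      P-W = S.trans {coeff P} (coeff-det (L [ i ≔ unit k ])) (SD.det-cong λ a b →
        S.reflexive (≡.cong-app (map-updateAt {f = coeff ∘_} {h = λ _ → E k} (λ _ → refl) L i a) b))

    M-⊛ : ∀ j k w s → (M j k ⊛ w) s ≈ (if does (j ≟ k) then shift w s else 0#) + - (A j k * w s)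
    M-⊛ j k w s = begin
      (M j k ⊛ w) s
        ≈⟨ ⊛-cong {g = w} (coeff-+ (if does (j ≟ k) then X else []) (-ₚ const (A j k))) (λ _ → ≈-refl) s ⟩
      ((coeff (if does (j ≟ k) then X else []) ⊕ coeff (-ₚ const (A j k))) ⊛ w) s
        ≈⟨ ⊛-distribʳ w (coeff (if does (j ≟ k) then X else [])) (coeff (-ₚ const (A j k))) s ⟩
      (coeff (if does (j ≟ k) then X else []) ⊛ w) s + (coeff (-ₚ const (A j k)) ⊛ w) s
        ≈⟨ +-cong (X-part (does (j ≟ k))) (begin
             (coeff (-ₚ const (A j k)) ⊛ w) s
               ≈⟨ ⊛-cong {g = w} (coeff-neg (const (A j k))) (λ _ → ≈-refl) s ⟩
             ((⊖ coeff (const (A j k))) ⊛ w) s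
               ≈⟨ SR.-‿distribˡ-* (coeff (const (A j k))) w s ⟨
             - (coeff (const (A j k)) ⊛ w) s
               ≈⟨ -‿cong (const-⊛ (A j k) w s) ⟩
             - (A j k * w s) ∎) ⟩
      (if does (j ≟ k) then shift w s else 0#) + - (A j k * w s) ∎
      where
      X-part : ∀ b → (coeff (if b then X else []) ⊛ w) s ≈ (if b then shift w s else 0#)
      X-part true  = X-⊛ w s
      X-part false = ⊛-zeroˡ w s

    E-δ : ∀ k l → E k l ≋ SM.δ k l
    E-δ k l with does (k ≟ l)
    ... | true  = coeff-1
    ... | false = λ _ → ≈-refl

    -- Cramer's rule.
    M-W : ∀ i j → SΣ.sum (λ k → M j k ⊛ W i k) ≋ (if does (i ≟ j) then p else 𝟘)
    M-W i j = S.trans {SΣ.sum (λ k → M j k ⊛ W i k)}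
        (S.sym {SD.∣ M [ i ≔ (λ l → SΣ.sum λ k → M j k ⊛ E k l) ] ∣} (SD.det-linear M i (M j) E))
        (S.trans {SD.∣ M [ i ≔ (λ l → SΣ.sum λ k → M j k ⊛ E k l) ] ∣}
           (SD.det-cong (SD.[]≔-cong M i row)) replaced)
      where
      row : ∀ l → SΣ.sum (λ k → M j k ⊛ E k l) ≋ M j l
      row l = S.trans {SΣ.sum λ k → M j k ⊛ E k l}
        (SΣ.sum-cong-≋ λ k → ⊛-cong {f = M j k} (λ _ → ≈-refl) (E-δ k l))
        (SM.·-identityʳ M j l)

      replaced : SD.∣ M [ i ≔ M j ] ∣ ≋ (if does (i ≟ j) then p else 𝟘)
      replaced with i ≟ j
      ... | yes refl = S.trans {SD.∣ M [ i ≔ M i ] ∣}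
              (SD.det-cong λ a b → S.reflexive (≡.cong-app (updateAt-id-local i M refl a) b))
              (S.sym {p} (coeff-det L))
      ... | no i≢j = SD.det-equalRows (M [ i ≔ M j ]) i≢j λ l → S.reflexive (≡.cong-app
              (≡.trans (updateAt-updates i M) (≡.sym (updateAt-minimal j i M (i≢j ∘ ≡.sym)))) l)

    V : ℕ → SqMat m
    V s j i = shift (W i j) s

    -- This compares the coefficients of Xˢ in (XI - A) · adj (XI - A) = p I. Because of the shift,
    -- `V (suc s)` holds the coefficients of Xˢ in the adjugate itself.
    V-suc : ∀ s → V s ≃ A · V (suc s) ⊞ p s ◃ δ
    V-suc s j i = begin
      V s j i
        ≈⟨ move (trans (sym (trans (sum-at (λ k → M j k ⊛ W i k) s) expanded)) (M-W i j s)) ⟩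
      (A · V (suc s)) j i + (if does (i ≟ j) then p else 𝟘) s
        ≈⟨ +-congˡ pδ ⟩
      (A · V (suc s)) j i + p s * δ j i ∎
      where
      move : ∀ {x y z} → x + - y ≈ z → x ≈ y + z
      move {x} {y} {z} h = begin
        x                ≈⟨ +-identityʳ x ⟨
        x + 0#           ≈⟨ +-congˡ (-‿inverseˡ y) ⟨
        x + (- y + y)    ≈⟨ +-assoc _ _ _ ⟨
        x + - y + y      ≈⟨ +-congʳ h ⟩
        z + y            ≈⟨ +-comm _ _ ⟩
        y + z            ∎

      pδ : (if does (i ≟ j) then p else 𝟘) s ≈ p s * δ j i
      pδ rewrite ≟-swap i j with does (j ≟ i)
      ... | true  = sym (*-identityʳ _)
      ... | false = sym (zeroʳ _)

      expanded : sum (λ k → (M j k ⊛ W i k) s) ≈ V s j i + - (A · V (suc s)) j i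
      expanded = begin
        sum (λ k → (M j k ⊛ W i k) s)
          ≈⟨ sum-cong-≋ (λ k → M-⊛ j k (W i k) s) ⟩
        sum (λ k → (if does (j ≟ k) then shift (W i k) s else 0#) + - (A j k * W i k s))
          ≈⟨ ∑-distrib-+ (λ k → if does (j ≟ k) then shift (W i k) s else 0#) (λ k → - (A j k * W i k s)) ⟩
        sum (λ k → if does (j ≟ k) then shift (W i k) s else 0#) + sum (λ k → - (A j k * W i k s))
          ≈⟨ +-cong (trans (sum-single j λ {k} k≢j → reflexive
                        (≡.cong (λ b → if b then shift (W i k) s else 0#) (dec-false (j ≟ k) (k≢j ∘ ≡.sym))))
                      (reflexive (≡.cong (λ b → if b then shift (W i j) s else 0#) (dec-true (j ≟ j) refl))))
                    (sum-neg (λ k → A j k * W i k s)) ⟩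
        V s j i + - (A · V (suc s)) j i ∎

    -- Only diagonal entries contain X, so the Euler operator turns row r of XI - A into X times the
    -- r-th unit row. Replacing that row in the determinant leaves X times a diagonal cofactor.
    θM : ∀ i j → θ (M i j) ≋ coeff X ⊛ E i j
    θM i j = S.trans {θ (M i j)} lhs (S.sym {coeff X ⊛ E i j} (X-⊛ (E i j)))
      where
      lhs : θ (M i j) ≋ shift (E i j)
      lhs zero = ≈-refl
      lhs (suc k) with does (i ≟ j)
      lhs (suc zero)    | true  = +-identityʳ _
      lhs (suc (suc k)) | true  = ×0≈0 (suc (suc k)) ≈-refl
      lhs (suc k)       | false = ×0≈0 (suc k) ≈-refl

    trace-V : ∀ s → trace (V s) ≈ s • p s
    trace-V s = begin
      sum (λ r → shift (W r r) s)
        ≈⟨ sum-cong-≋ (λ r → row r s) ⟨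
      sum (λ r → SD.∣ M [ r ≔ θ ∘ M r ] ∣ s)
        ≈⟨ sum-at (λ r → SD.∣ M [ r ≔ θ ∘ M r ] ∣) s ⟨
      SΣ.sum (λ r → SD.∣ M [ r ≔ θ ∘ M r ] ∣) s
        ≈⟨ ∂-det M s ⟨
      θ SD.∣ M ∣ s
        ≈⟨ θ-cong (coeff-det L) s ⟨
      s • p s ∎
      where
      open SD.Derivation θ θ-cong θ-⊕ θ-⊛ (θ-constant {𝟘} λ _ → ≈-refl) (θ-constant {𝟙} λ _ → ≈-refl)
                         (θ-constant {⊖ 𝟙} λ _ → -0#≈0#)
      row : ∀ r → SD.∣ M [ r ≔ θ ∘ M r ] ∣ ≋ shift (W r r)
      row r = S.trans {SD.∣ M [ r ≔ θ ∘ M r ] ∣}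
        (SD.det-cong (SD.[]≔-cong M r entry))
        (S.trans {SD.∣ M [ r ≔ (λ l → coeff X ⊛ E r l ⊕ 𝟘) ] ∣}
          -- A sum over `Fin 1` unfolds to its only term plus `𝟘`, which accounts for the `𝟘` here
          -- and in `entry`.
          (SD.det-linear {l = 1} M r (λ _ → coeff X) (λ _ → E r))
          (S.trans {coeff X ⊛ W r r ⊕ 𝟘} (S.+-identityʳ (coeff X ⊛ W r r)) (X-⊛ (W r r))))
        where
        entry : ∀ l → θ (M r l) ≋ coeff X ⊛ E r l ⊕ 𝟘
        entry l = S.trans {θ (M r l)} (θM r l) (S.sym {coeff X ⊛ E r l ⊕ 𝟘} (S.+-identityʳ (coeff X ⊛ E r l)))

    W-bound : ∃[ b ] (∀ i {s} → b ℕ.≤ s → ∀ k → W i k s ≈ 0#)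
    W-bound = common-bound (λ i s → ∀ k → W i k s ≈ 0#) λ i →
      let b , W≈0 = common-bound (λ k s → W i k s ≈ 0#) (W-beyond i) in b , λ b≤s k → W≈0 k b≤s

    -- Downward induction from the crude bound `b`: above N the coefficient `p s` is zero, so `V s`
    -- is A times `V (suc s)` and vanishes with it. This replaces a degree count for the cofactors.
    -- In `go`, `d` is the number of steps that suffice to pass `b`.
    V-beyond : ∀ {N} → (∀ {s} → N ℕ.< s → p s ≈ 0#) → ∀ {s} → N ℕ.< s → ∀ j i → V s j i ≈ 0#
    V-beyond {N} p≈0 {s} N<s = go b s (ℕ.m<m+n b (ℕ.≤-<-trans z≤n N<s)) N<s
      where
      b = proj₁ W-bound
      go : ∀ d s → b ℕ.< d ℕ.+ s → N ℕ.< s → ∀ j i → V s j i ≈ 0#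
      go zero    (suc s) (s≤s b≤s) N<s j i = proj₂ W-bound i b≤s j
      go (suc d) s b<d+s N<s j i = begin
        V s j i
          ≈⟨ V-suc s j i ⟩
        (A · V (suc s)) j i + p s * δ j i
          ≈⟨ +-cong (sum-zero λ k → trans (*-congˡ (go d (suc s) (≡.subst (b ℕ.<_) (≡.sym (ℕ.+-suc d s)) b<d+s)
                                                      (ℕ.m<n⇒m<1+n N<s) k i)) (zeroʳ _))
                    (trans (*-congʳ (p≈0 N<s)) (zeroˡ _)) ⟩
        0# + 0#
          ≈⟨ +-identityʳ 0# ⟩
        0# ∎

    newtonIdentities : NewtonIdentities p (closedWalks A)
    newtonIdentities = record
      { τ = τ
      ; τ-suc = τ-suc
      ; τ-zero = trace-V
      ; τ-0 = λ t → trace-act-zero t λ j i → ≈-refl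
      ; τ-top = λ {N} p≈0 pN≈1 t → begin
          τ t N
            ≈⟨ τ-suc t N ⟩
          τ (suc t) (suc N) + p N * closedWalks A t
            ≈⟨ +-cong (trace-act-zero (suc t) (V-beyond p≈0 (ℕ.n<1+n N))) (*-congʳ pN≈1) ⟩
          0# + 1# * closedWalks A t
            ≈⟨ trans (+-identityˡ _) (*-identityˡ _) ⟩
          closedWalks A t ∎
      }
      where
      τ : ℕ → ℕ → Carrier
      τ t s = trace (act A t (V s))

      act-zero : ∀ t {X} → (∀ i j → X i j ≈ 0#) → ∀ i j → act A t X i j ≈ 0#
      act-zero zero    X≈0 = X≈0
      act-zero (suc t) X≈0 = act-zero t λ i j → sum-zero λ k → trans (*-congˡ (X≈0 k j)) (zeroʳ _)

      trace-act-zero : ∀ t {X} → (∀ i j → X i j ≈ 0#) → trace (act A t X) ≈ 0#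
      trace-act-zero t X≈0 = sum-zero λ i → act-zero t X≈0 i i

      τ-suc : ∀ t s → τ t s ≈ τ (suc t) (suc s) + p s * closedWalks A t
      τ-suc t s = begin
        trace (act A t (V s))
          ≈⟨ trace-cong (act-cong A t (V-suc s)) ⟩
        trace (act A t (A · V (suc s) ⊞ p s ◃ δ))
          ≈⟨ trace-cong (act-⊞ A t (A · V (suc s)) (p s ◃ δ)) ⟩
        trace (act A (suc t) (V (suc s)) ⊞ act A t (p s ◃ δ))
          ≈⟨ trace-⊞ (act A (suc t) (V (suc s))) (act A t (p s ◃ δ)) ⟩
        τ (suc t) (suc s) + trace (act A t (p s ◃ δ))
          ≈⟨ +-congˡ (trans (trace-cong (act-◃ A t (p s) δ)) (trace-◃ (p s) (act A t δ))) ⟩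
        τ (suc t) (suc s) + p s * closedWalks A t ∎

  module _ {p q w v} (P : NewtonIdentities p w) (Q : NewtonIdentities q v) (p≈q : p ≋ q)
           {N} (p≈0 : ∀ {s} → N ℕ.< s → p s ≈ 0#) (pN≈1 : p N ≈ 1#) where
    private
      module Np = NewtonIdentities P
      module Nq = NewtonIdentities Q

    -- Read backwards, `τ-suc` obtains `τ (suc t) (suc s)` from `τ t s`, a coefficient and `w t`.
    -- Descending this diagonal ends at `τ-zero` or `τ-0`, whose values are fixed by the polynomial,
    -- and meets only power sums with exponent below t.
    τ-unique : ∀ t s → (∀ {r} → r ℕ.< t → w r ≈ v r) → Np.τ t s ≈ Nq.τ t s
    τ-unique zero    s       h = trans (Np.τ-zero s) (trans (×-congʳ s (p≈q s)) (sym (Nq.τ-zero s)))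
    τ-unique (suc t) zero    h = trans (Np.τ-0 (suc t)) (sym (Nq.τ-0 (suc t)))
    τ-unique (suc t) (suc s) h = ∙-cancelʳ (p s * w t) _ _ (begin
      Np.τ (suc t) (suc s) + p s * w t
        ≈⟨ Np.τ-suc t s ⟨
      Np.τ t s
        ≈⟨ τ-unique t s (h ∘ ℕ.m<n⇒m<1+n) ⟩
      Nq.τ t s
        ≈⟨ Nq.τ-suc t s ⟩
      Nq.τ (suc t) (suc s) + q s * v t
        ≈⟨ +-congˡ (*-cong (p≈q s) (h (ℕ.n<1+n t))) ⟨
      Nq.τ (suc t) (suc s) + p s * w t ∎)

    -- At the degree N of the polynomial `τ t N` is the power sum itself, which closes a strong
    -- induction on t. Nothing is divided.
    power-sums-unique : ∀ t → w t ≈ v t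
    power-sums-unique = <-rec (λ t → w t ≈ v t) λ t h → begin
      w t        ≈⟨ Np.τ-top p≈0 pN≈1 t ⟨
      Np.τ t N    ≈⟨ τ-unique t N h ⟩
      Nq.τ t N    ≈⟨ Nq.τ-top (λ {s} N<s → trans (sym (p≈q s)) (p≈0 N<s)) (trans (sym (p≈q N)) pN≈1) t ⟩
      v t        ∎

  coeff-X-a* : ∀ a q k → coeff ((X +ₚ (-ₚ const a)) *ₚ q) (suc k) ≈ - a * coeff q (suc k) + coeff q k
  coeff-X-a* a q k = begin
    coeff ((X +ₚ (-ₚ const a)) *ₚ q) (suc k)
      ≈⟨ coeff-* (X +ₚ (-ₚ const a)) q (suc k) ⟩
    (0# + - a) * coeff q (suc k) + (coeff (const 1#) ⊛ coeff q) k
      ≈⟨ +-cong (*-congʳ (+-identityˡ _)) (trans (const-⊛ 1# (coeff q) k) (*-identityˡ _)) ⟩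
    - a * coeff q (suc k) + coeff q k ∎

  -- Together with `∏-monic` this provides the degree and the leading coefficient of the
  -- characteristic polynomial. They are taken from the list of roots, so neither has to be
  -- extracted from the determinant.
  ∏-beyond : ∀ σ {s} → length σ ℕ.< s → coeff ∏[X- σ ] s ≈ 0#
  ∏-beyond []      {suc s} _         = ≈-refl
  ∏-beyond (a ∷ σ) {suc s} (s≤s l<s) = trans (coeff-X-a* a ∏[X- σ ] s)
    (trans (+-cong (trans (*-congˡ (∏-beyond σ (ℕ.m<n⇒m<1+n l<s))) (zeroʳ _)) (∏-beyond σ l<s)) (+-identityʳ 0#))

  ∏-monic : ∀ σ → coeff ∏[X- σ ] (length σ) ≈ 1#
  ∏-monic []      = ≈-refl
  ∏-monic (a ∷ σ) = trans (coeff-X-a* a ∏[X- σ ] (length σ))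
    (trans (+-cong (trans (*-congˡ (∏-beyond σ (ℕ.n<1+n _))) (zeroʳ _)) (∏-monic σ)) (+-identityˡ 1#))

-- Closed walks

bit : Bool → ℕ
bit b = if b then 1 else 0

module Mℕ = Matrices ℕ.+-*-commutativeSemiring
module Σℕ = Sum ℕ.+-*-semiring

adjacency : ∀ {n} → Graph n → Mℕ.SqMat n
adjacency G i j = bit (adj G i j)

module NaturalMatrices {c ℓ} (R : CommutativeRing c ℓ) where
  open CommutativeRing R hiding (zero) renaming (refl to ≈-refl)
  open import Algebra.Definitions.RawMonoid (RawRing.+-rawMonoid rawRing) using (sum) renaming (_×_ to _•_)
  open import Algebra.Properties.Monoid.Mult +-monoid using (×-homo-+)
  open import Algebra.Properties.Semiring.Mult semiring using (×1-homo-*)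
  open import Algebra.Properties.AbelianGroup +-abelianGroup using (∙-cancelˡ)
  open Matrices commutativeSemiring

  ι : ℕ → Carrier
  ι k = k • 1#

  -- Characteristic zero enters here: equal traces in the field become equal numbers of closed
  -- walks.
  ι-injective : (∀ k → ¬ (ι (suc k) ≈ 0#)) → ∀ {k l} → ι k ≈ ι l → k ≡ l
  ι-injective char0 {zero}  {zero}  _  = refl
  ι-injective char0 {zero}  {suc l} eq = contradiction (sym eq) (char0 l)
  ι-injective char0 {suc k} {zero}  eq = contradiction eq (char0 k)
  ι-injective char0 {suc k} {suc l} eq = ≡.cong suc (ι-injective char0 (∙-cancelˡ 1# _ _ eq))

  ι-bit : ∀ b → ι (bit b) ≈ (if b then 1# else 0#)
  ι-bit true  = +-identityʳ 1#
  ι-bit false = ≈-refl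

  ι-sum : ∀ {n} {f : Fin n → ℕ} {g} → (∀ i → ι (f i) ≈ g i) → ι (Σℕ.sum f) ≈ sum g
  ι-sum {zero}  f≈g = ≈-refl
  ι-sum {suc n} {f} f≈g = trans (×-homo-+ 1# (f zero) _) (+-cong (f≈g zero) (ι-sum (f≈g ∘ suc)))

  ι-act : ∀ {n} {A X : Mℕ.SqMat n} {B Y} → (∀ i j → ι (A i j) ≈ B i j) → (∀ i j → ι (X i j) ≈ Y i j) →
          ∀ t i j → ι (Mℕ.act A t X i j) ≈ act B t Y i j
  ι-act A≈B X≈Y zero    = X≈Y
  ι-act {A = A} {X} A≈B X≈Y (suc t) = ι-act A≈B (λ i j → ι-sum λ k →
    trans (×1-homo-* (A i k) (X k j)) (*-cong (A≈B i k) (X≈Y k j))) t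

  ι-closedWalks : ∀ {n} {A : Mℕ.SqMat n} {B} → (∀ i j → ι (A i j) ≈ B i j) →
                  ∀ t → ι (Mℕ.closedWalks A t) ≈ closedWalks B t
  ι-closedWalks A≈B t = ι-sum λ i → ι-act A≈B (λ i j → ι-bit (does (i ≟ j))) t i i

-- From cospectrality to equal numbers of closed walks.

module _ {c ℓ₁ ℓ₂} (K : HeytingField c ℓ₁ ℓ₂) where
  open HeytingField K using (heytingCommutativeRing)
  open HeytingCommutativeRing heytingCommutativeRing using (commutativeRing)
  open CommutativeRing commutativeRing hiding (zero) renaming (refl to ≈-refl)
  open Spectrum K
  open Polynomial rawRing
  open PowerSeries commutativeRing
  open CharacteristicPolynomial commutativeRing
  open NaturalMatrices commutativeRing
  open Permutationₛ setoid using (_↭_)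

  ∏-cong-↭ : ∀ {σ τ} → σ ↭ τ → coeff ∏[X- σ ] ≋ coeff ∏[X- τ ]
  ∏-cong-↭ {σ} {τ} σ↭τ = S.trans {coeff ∏[X- σ ]} (as-foldr σ) (S.trans {product σ}
      (↭.foldr-commMonoid S.setoid S.*-isCommutativeMonoid (↭.map⁺ setoid S.setoid factor-cong σ↭τ))
      (S.sym {coeff ∏[X- τ ]} (as-foldr τ)))
    where
    factor : Carrier → Series
    factor a = coeff (X +ₚ (-ₚ const a))

    factor-cong : ∀ {a b} → a ≈ b → factor a ≋ factor b
    factor-cong a≈b zero          = +-congˡ (-‿cong a≈b)
    factor-cong a≈b (suc zero)    = ≈-refl
    factor-cong a≈b (suc (suc k)) = ≈-refl

    product : List Carrier → Series
    product σ = foldr _⊛_ 𝟙 (map factor σ)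

    as-foldr : ∀ σ → coeff ∏[X- σ ] ≋ product σ
    as-foldr []      = coeff-1
    as-foldr (a ∷ σ) = S.trans {coeff ∏[X- a ∷ σ ]} (coeff-* (X +ₚ (-ₚ const a)) ∏[X- σ ])
      (⊛-cong {f = factor a} (λ _ → ≈-refl) (as-foldr σ))

  cospectral⇒closedWalks : CharacteristicZero → ∀ {m n} {G : Graph m} {H : Graph n} → Cospectral G H →
    ∀ t → Mℕ.closedWalks (adjacency G) t ≡ Mℕ.closedWalks (adjacency H) t
  cospectral⇒closedWalks char0 {G = G} {H} (σ , τ , spG , spH , σ↭τ) t =
    ι-injective char0 (trans (ι-closedWalks (λ i j → ι-bit (adj G i j)) t)
      (trans (power-sums-unique (newtonIdentities (adjacencyMatrix G)) (newtonIdentities (adjacencyMatrix H))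
                (λ k → trans (spG k) (trans (∏-cong-↭ σ↭τ k) (sym (spH k))))
                (λ {s} l<s → trans (spG s) (∏-beyond σ l<s)) (trans (spG _) (∏-monic σ)) t)
             (sym (ι-closedWalks (λ i j → ι-bit (adj H i j)) t))))

open import Data.Nat.Base using (_+_; _*_)
open ≡ using (sym; trans; cong; cong₂; subst)
open ≡.≡-Reasoning
open +-*-Solver using (solve; _:=_; _:+_; _:*_; con)
open Mℕ
open Σℕ using (sum; sum-cong-≗; ∑-comm; ∑-distrib-+; *-distribˡ-sum; *-distribʳ-sum)

-- Rank one

term≤sum : ∀ {n} (f : Fin n → ℕ) i → f i ≤ sum f
term≤sum f zero    = ℕ.m≤m+n _ _
term≤sum f (suc i) = ℕ.≤-trans (term≤sum (f ∘ suc) i) (ℕ.m≤n+m _ _)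

sum-mono : ∀ {n} {f g : Fin n → ℕ} → (∀ i → f i ≤ g i) → sum f ≤ sum g
sum-mono {zero}  f≤g = z≤n
sum-mono {suc n} f≤g = ℕ.+-mono-≤ (f≤g zero) (sum-mono (f≤g ∘ suc))

sum-squeeze : ∀ {n} {f g : Fin n → ℕ} → (∀ i → f i ≤ g i) → sum g ≤ sum f → ∀ i → f i ≡ g i
sum-squeeze {suc n} {f} {g} f≤g Σg≤Σf = λ where
    zero    → ℕ.≤-antisym (f≤g zero)
      (ℕ.+-cancelʳ-≤ _ _ _ (ℕ.≤-trans Σg≤Σf (ℕ.+-monoʳ-≤ (f zero) (sum-mono (f≤g ∘ suc)))))
    (suc i) → sum-squeeze (f≤g ∘ suc)
      (ℕ.+-cancelˡ-≤ (f zero) _ _ (ℕ.≤-trans (ℕ.+-monoˡ-≤ _ (f≤g zero)) Σg≤Σf)) i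

sum-mono-< : ∀ {n} {f g : Fin n → ℕ} → (∀ i → f i ≤ g i) → ∀ i → f i < g i → sum f < sum g
sum-mono-< f≤g i f<g = ℕ.≰⇒> λ Σg≤Σf → ℕ.<⇒≢ f<g (sum-squeeze f≤g Σg≤Σf i)

sum*sum : ∀ {m n} (f : Fin m → ℕ) (g : Fin n → ℕ) → sum f * sum g ≡ sum λ i → sum λ j → f i * g j
sum*sum f g = trans (*-distribʳ-sum (sum g) f) (sum-cong-≗ λ i → *-distribˡ-sum (f i) g)

-- This is a² + b² = 2ab + (b - a)², with b written as a + e to avoid the subtraction.
square-expansion : ∀ a e → a * a + (a + e) * (a + e) ≡ 2 * (a * (a + e)) + e * e
square-expansion = solve 2 (λ a e → a :* a :+ (a :+ e) :* (a :+ e) := con 2 :* (a :* (a :+ e)) :+ e :* e) refl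

2ab≤a²+b² : ∀ a b → 2 * (a * b) ≤ a * a + b * b
2ab≤a²+b² a b with ℕ.≤-total a b
... | inj₁ a≤b with e , refl ← ℕ.m≤n⇒∃[o]m+o≡n a≤b =
  ℕ.≤-trans (ℕ.m≤m+n _ (e * e)) (ℕ.≤-reflexive (sym (square-expansion a e)))
... | inj₂ b≤a with e , refl ← ℕ.m≤n⇒∃[o]m+o≡n b≤a = ℕ.≤-trans
  (ℕ.≤-trans (ℕ.≤-reflexive (cong (2 *_) (ℕ.*-comm (b + e) b))) (ℕ.m≤m+n _ (e * e)))
  (ℕ.≤-reflexive (trans (sym (square-expansion b e)) (ℕ.+-comm (b * b) _)))

2ab≡a²+b²⇒a≡b : ∀ a b → 2 * (a * b) ≡ a * a + b * b → a ≡ b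
2ab≡a²+b²⇒a≡b a b eq = case ℕ.≤-total a b of λ where
    (inj₁ a≤b) → ordered a≤b eq
    (inj₂ b≤a) → sym (ordered b≤a (trans (cong (2 *_) (ℕ.*-comm b a)) (trans eq (ℕ.+-comm (a * a) _))))
  where
  ordered : ∀ {a b} → a ≤ b → 2 * (a * b) ≡ a * a + b * b → a ≡ b
  ordered {a} a≤b eq with e , refl ← ℕ.m≤n⇒∃[o]m+o≡n a≤b =
    sym (trans (cong (a +_) (reduce (ℕ.m*n≡0⇒m≡0∨n≡0 e (ℕ.+-cancelˡ-≡ (2 * (a * (a + e))) (e * e) 0
      (trans (sym (square-expansion a e)) (trans (sym eq) (sym (ℕ.+-identityʳ _)))))))) (ℕ.+-identityʳ a))

module _ {n} (u v : Fin n → ℕ) where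
  private
    ⟨_,_⟩ : (Fin n → ℕ) → (Fin n → ℕ) → ℕ
    ⟨ f , g ⟩ = sum λ k → f k * g k

    cross : ⟨ u , v ⟩ * ⟨ u , v ⟩ ≡ sum λ k → sum λ l → (u k * v l) * (u l * v k)
    cross = trans (sum*sum (λ k → u k * v k) (λ l → u l * v l))
      (sum-cong-≗ λ k → sum-cong-≗ λ l →
        solve 4 (λ a b c d → (a :* b) :* (c :* d) := (a :* d) :* (c :* b)) refl (u k) (v k) (u l) (v l))

    2cross : 2 * (⟨ u , v ⟩ * ⟨ u , v ⟩) ≡ sum λ k → sum λ l → 2 * ((u k * v l) * (u l * v k))
    2cross = trans (cong (2 *_) cross) (trans (*-distribˡ-sum 2 (λ k → sum λ l → (u k * v l) * (u l * v k)))
      (sum-cong-≗ λ k → *-distribˡ-sum 2 (λ l → (u k * v l) * (u l * v k))))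

    squares : 2 * (⟨ u , u ⟩ * ⟨ v , v ⟩) ≡
              sum λ k → sum λ l → (u k * v l) * (u k * v l) + (u l * v k) * (u l * v k)
    squares = begin
      2 * (⟨ u , u ⟩ * ⟨ v , v ⟩)
        ≡⟨ cong (⟨ u , u ⟩ * ⟨ v , v ⟩ +_) (trans (ℕ.+-identityʳ _) (ℕ.*-comm ⟨ u , u ⟩ _)) ⟩
      ⟨ u , u ⟩ * ⟨ v , v ⟩ + ⟨ v , v ⟩ * ⟨ u , u ⟩
        ≡⟨ cong₂ _+_ (sum*sum (λ k → u k * u k) (λ l → v l * v l)) (sum*sum (λ k → v k * v k) (λ l → u l * u l)) ⟩
      (sum λ k → sum λ l → u k * u k * (v l * v l)) + (sum λ k → sum λ l → v k * v k * (u l * u l))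
        ≡⟨ ∑-distrib-+ (λ k → sum λ l → u k * u k * (v l * v l)) (λ k → sum λ l → v k * v k * (u l * u l)) ⟨
      (sum λ k → (sum λ l → u k * u k * (v l * v l)) + (sum λ l → v k * v k * (u l * u l)))
        ≡⟨ sum-cong-≗ (λ k → trans
             (sym (∑-distrib-+ (λ l → u k * u k * (v l * v l)) (λ l → v k * v k * (u l * u l))))
             (sum-cong-≗ λ l → solve 4 (λ a b c d → a :* a :* (d :* d) :+ b :* b :* (c :* c) :=
                a :* d :* (a :* d) :+ c :* b :* (c :* b)) refl (u k) (v k) (u l) (v l))) ⟩
      (sum λ k → sum λ l → (u k * v l) * (u k * v l) + (u l * v k) * (u l * v k)) ∎

    pointwise : ∀ k l → 2 * ((u k * v l) * (u l * v k)) ≤ (u k * v l) * (u k * v l) + (u l * v k) * (u l * v k)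
    pointwise k l = 2ab≤a²+b² (u k * v l) (u l * v k)

  -- Twice either side is a double sum over k and l. The summands are 2xy and x² + y² for x =
  -- `u k * v l` and y = `u l * v k`, so the inequality holds term by term, and equality of the sums
  -- forces x = y for all k and l.
  cauchy-schwarz : ⟨ u , v ⟩ * ⟨ u , v ⟩ ≤ ⟨ u , u ⟩ * ⟨ v , v ⟩
  cauchy-schwarz = ℕ.*-cancelˡ-≤ 2 (ℕ.≤-trans (ℕ.≤-reflexive 2cross)
    (ℕ.≤-trans (sum-mono λ k → sum-mono (pointwise k)) (ℕ.≤-reflexive (sym squares))))

  cauchy-schwarz-equality : ⟨ u , v ⟩ * ⟨ u , v ⟩ ≡ ⟨ u , u ⟩ * ⟨ v , v ⟩ → ∀ k l → u k * v l ≡ u l * v k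
  cauchy-schwarz-equality eq k l = 2ab≡a²+b²⇒a≡b (u k * v l) (u l * v k)
    (sum-squeeze (pointwise k) (ℕ.≤-reflexive (sym (sum-squeeze (λ k → sum-mono (pointwise k))
      (ℕ.≤-reflexive (trans (sym squares) (trans (cong (2 *_) (sym eq)) 2cross))) k))) l)

-- For symmetric M the matrix M² is positive semidefinite, and (Σ μ)² = Σ μ² for nonnegative
-- eigenvalues μ leaves at most one of them nonzero. The squares matter: A² + 2A may have negative
-- eigenvalues, coming from eigenvalues of A between -2 and 0, so the same equation for M itself
-- would not suffice.
RankOneTrace : ∀ {n} → SqMat n → Set
RankOneTrace M = trace (M · M) * trace (M · M) ≡ trace ((M · M) · (M · M))

module _ {n} (M : SqMat n) where
  private
    P : SqMat n
    P = M · M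

  -- The left side of `RankOneTrace` is the sum of `P i i * P j j`, the right side that of
  -- `P i j * P j i`. Since P is the Gram matrix of the rows of M, Cauchy-Schwarz compares them term
  -- by term, and equality of the sums makes any two rows of M parallel. The minor is this
  -- proportionality at the columns i and j.
  rankOneTrace⇒minors-vanish : (∀ i j → M i j ≡ M j i) → RankOneTrace M → ∀ i j → M i i * M j j ≡ M i j * M i j
  rankOneTrace⇒minors-vanish M-sym h i j = trans
    (cauchy-schwarz-equality (M i) (M j) (rows-parallel i j) i j) (cong (M i j *_) (M-sym j i))
    where
    P-rows : ∀ i j → P i j ≡ sum λ k → M i k * M j k
    P-rows i j = sum-cong-≗ λ k → cong (M i k *_) (M-sym k j)

    P-sym : ∀ i j → P j i ≡ P i j
    P-sym i j = sum-cong-≗ λ k → trans (ℕ.*-comm (M j k) _) (cong₂ _*_ (M-sym k i) (M-sym j k))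

    below : ∀ i j → P i j * P j i ≤ P i i * P j j
    below i j rewrite P-sym i j | P-rows i j | P-rows i i | P-rows j j = cauchy-schwarz (M i) (M j)

    equal : ∀ i j → P i j * P j i ≡ P i i * P j j
    equal i = sum-squeeze (below i) (ℕ.≤-reflexive (sym (sum-squeeze (λ i → sum-mono (below i))
      (ℕ.≤-reflexive (trans (sym (sum*sum (λ i → P i i) (λ j → P j j))) h)) i)))

    rows-parallel : ∀ i j → (sum λ k → M i k * M j k) * (sum λ k → M i k * M j k) ≡
                            (sum λ k → M i k * M i k) * (sum λ k → M j k * M j k)
    rows-parallel i j = trans (cong₂ _*_ (sym (P-rows i j)) (trans (sym (P-rows i j)) (sym (P-sym i j))))
      (trans (equal i j) (cong₂ _*_ (P-rows i i) (P-rows j j)))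

  outerProduct⇒rankOneTrace : ∀ d (x : Fin n → ℕ) → (∀ i j → M i j ≡ d * (x i * x j)) → RankOneTrace M
  outerProduct⇒rankOneTrace d x M≡ = trans (sum*sum (λ i → P i i) (λ j → P j j))
    (sum-cong-≗ λ i → sum-cong-≗ λ j → begin
      P i i * P j j
        ≡⟨ cong₂ _*_ (P≡ i i) (P≡ j j) ⟩
      e * (x i * x i) * (e * (x j * x j))
        ≡⟨ solve 3 (λ e a b → e :* (a :* a) :* (e :* (b :* b)) := e :* (a :* b) :* (e :* (b :* a))) refl
             e (x i) (x j) ⟩
      e * (x i * x j) * (e * (x j * x i))
        ≡⟨ cong₂ _*_ (P≡ i j) (P≡ j i) ⟨
      P i j * P j i ∎)
    where
    e : ℕ
    e = sum λ k → d * d * (x k * x k)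
    P≡ : ∀ i j → P i j ≡ e * (x i * x j)
    P≡ i j = trans (sum-cong-≗ λ k → trans (cong₂ _*_ (M≡ i k) (M≡ k j))
        (solve 4 (λ d a b c → d :* (a :* c) :* (d :* (c :* b)) := d :* d :* (c :* c) :* (a :* b)) refl
          d (x i) (x j) (x k)))
      (sym (*-distribʳ-sum (x i * x j) (λ k → d * d * (x k * x k))))

-- Traces of powers of A² + 2A from closed walks.

A²+2A : ∀ {n} → SqMat n → SqMat n
A²+2A A = A · A ⊞ 2 ◃ A

module _ {n} (A : SqMat n) where
  -- The powers of A² + 2A, written with left multiplications by A alone, so that `act` can absorb
  -- each factor.
  M^ : ℕ → SqMat n
  M^ zero    = δ
  M^ (suc k) = A · (A · M^ k) ⊞ 2 ◃ (A · M^ k)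

  private
    M : SqMat n
    M = A²+2A A

    M^-suc : ∀ k {X} → M^ k ≃ X → M^ (suc k) ≃ M · X
    M^-suc k {X} eq i j = begin
      (A · (A · M^ k)) i j + 2 * (A · M^ k) i j
        ≡⟨ cong₂ _+_ (trans (·-congˡ {A = A} (·-congˡ {A = A} eq) i j) (sym (·-assoc A A X i j)))
             (trans (cong (2 *_) (·-congˡ {A = A} eq i j)) (sym (◃-· 2 A X i j))) ⟩
      ((A · A) · X) i j + ((2 ◃ A) · X) i j
        ≡⟨ ·-distribʳ (A · A) (2 ◃ A) X i j ⟨
      (M · X) i j ∎

  M^1 : M^ 1 ≃ M
  M^1 i j = trans (M^-suc 0 {δ} (λ _ _ → refl) i j) (·-identityʳ M i j)

  M^2 : M^ 2 ≃ M · M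
  M^2 = M^-suc 1 M^1

  M^4 : M^ 4 ≃ (M · M) · (M · M)
  M^4 i j = trans (M^-suc 3 (M^-suc 2 M^2) i j) (sym (·-assoc M M (M · M) i j))

module _ {m n} (A : SqMat m) (B : SqMat n) (same : ∀ t → closedWalks A t ≡ closedWalks B t) where
  -- A factor A² + 2A is traded for two and for one more factors of A on the left. The exponent t
  -- must hence be general in the induction, which ends at the numbers of closed walks.
  trace-act-M^ : ∀ k t → trace (act A t (M^ A k)) ≡ trace (act B t (M^ B k))
  trace-act-M^ zero    t = same t
  trace-act-M^ (suc k) t = trans (step A)
    (trans (cong₂ (λ x y → x + 2 * y) (trace-act-M^ k (suc (suc t))) (trace-act-M^ k (suc t))) (sym (step B)))
    where
    step : ∀ {n} (A : SqMat n) → trace (act A t (M^ A (suc k))) ≡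
           trace (act A (suc (suc t)) (M^ A k)) + 2 * trace (act A (suc t) (M^ A k))
    step A = begin
      trace (act A t (A · (A · M^ A k) ⊞ 2 ◃ (A · M^ A k)))
        ≡⟨ trace-cong (act-⊞ A t (A · (A · M^ A k)) (2 ◃ (A · M^ A k))) ⟩
      trace (act A (suc (suc t)) (M^ A k) ⊞ act A t (2 ◃ (A · M^ A k)))
        ≡⟨ trace-⊞ (act A (suc (suc t)) (M^ A k)) (act A t (2 ◃ (A · M^ A k))) ⟩
      trace (act A (suc (suc t)) (M^ A k)) + trace (act A t (2 ◃ (A · M^ A k)))
        ≡⟨ cong (trace (act A (suc (suc t)) (M^ A k)) +_)
             (trans (trace-cong (act-◃ A t 2 (A · M^ A k))) (trace-◃ 2 (act A (suc t) (M^ A k)))) ⟩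
      trace (act A (suc (suc t)) (M^ A k)) + 2 * trace (act A (suc t) (M^ A k)) ∎

  trace-A²+2A : trace (A²+2A A) ≡ trace (A²+2A B)
  trace-A²+2A = trans (sym (trace-cong (M^1 A))) (trans (trace-act-M^ 1 0) (trace-cong (M^1 B)))

  rankOneTrace-transfer : RankOneTrace (A²+2A B) → RankOneTrace (A²+2A A)
  rankOneTrace-transfer h = trans (cong₂ _*_ square square) (trans h (sym fourth))
    where
    square : trace (A²+2A A · A²+2A A) ≡ trace (A²+2A B · A²+2A B)
    square = trans (sym (trace-cong (M^2 A))) (trans (trace-act-M^ 2 0) (trace-cong (M^2 B)))
    fourth : trace ((A²+2A A · A²+2A A) · (A²+2A A · A²+2A A)) ≡ trace ((A²+2A B · A²+2A B) · (A²+2A B · A²+2A B))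
    fourth = trans (sym (trace-cong (M^4 A))) (trans (trace-act-M^ 4 0) (trace-cong (M^4 B)))

-- The complement of the friendship graph

sum-constant : ∀ n c → (sum {n} λ _ → c) ≡ n * c
sum-constant zero    c = refl
sum-constant (suc n) c = cong (c +_) (sum-constant n c)

sum-combine : ∀ {n} (f : Fin (n * 2) → ℕ) → sum f ≡ sum λ a → sum λ (b : Fin 2) → f (combine {n} a b)
sum-combine {zero}  f = refl
sum-combine {suc n} f = trans
  (solve 3 (λ a b c → a :+ (b :+ c) := (a :+ (b :+ con 0)) :+ c) refl (f zero) (f (suc zero)) _)
  (cong (f zero + (f (suc zero) + 0) +_) (sum-combine {n} (λ i → f (suc (suc i)))))

module _ {n : ℕ} where
  private
    q : Fin (n * 2) → Fin n
    q = quotient {n} 2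

    -- The block matrix of the n pairs, diagonal included. On the vertices other than the isolated
    -- one, `a` is the all-ones matrix minus `C`.
    C : SqMat (n * 2)
    C i j = bit (does (q i ≟ q j))

  adj-complement-friendship : ∀ i j → adj (complement (friendship n)) (suc i) (suc j) ≡ not (does (q i ≟ q j))
  adj-complement-friendship i j with i ≟ j
  ... | yes refl = sym (cong not (dec-true (q i ≟ q i) refl))
  ... | no  _    = refl

  adj-complement-friendship-zeroʳ : ∀ i → adj (complement (friendship n)) i zero ≡ false
  adj-complement-friendship-zeroʳ zero    = refl
  adj-complement-friendship-zeroʳ (suc i) = refl

  private
    a : SqMat (n * 2)
    a i j = adjacency (complement (friendship n)) (suc i) (suc j)

    a+C : ∀ i j → a i j + C i j ≡ 1
    a+C i j rewrite adj-complement-friendship i j with does (q i ≟ q j)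
    ... | true  = refl
    ... | false = refl

    C-sym : ∀ i j → C i j ≡ C j i
    C-sym i j = cong bit (≟-swap (q i) (q j))

    rowsum-C : ∀ j → sum (λ k → C k j) ≡ 2
    rowsum-C j = begin
      sum (λ k → C k j)
        ≡⟨ sum-combine {n} (λ k → C k j) ⟩
      sum (λ a → sum λ (b : Fin 2) → C (combine {n} a b) j)
        ≡⟨ sum-cong-≗ (λ a → sum-cong-≗ λ b → cong (λ x → bit (does (proj₁ x ≟ q j))) (remQuot-combine {n} a b)) ⟩
      sum (λ a → sum λ (b : Fin 2) → bit (does (a ≟ q j)))
        ≡⟨ sum-single (q j) (λ {a} a≢ → cong (λ b → bit b + (bit b + 0)) (dec-false (a ≟ q j) a≢)) ⟩
      bit (does (q j ≟ q j)) + (bit (does (q j ≟ q j)) + 0)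
        ≡⟨ cong (λ b → bit b + (bit b + 0)) (dec-true (q j ≟ q j) refl) ⟩
      2 ∎

    a*C : ∀ i j k → a i k * C k j ≡ C k j * a i j
    a*C i j k rewrite adj-complement-friendship i k | adj-complement-friendship i j with q k ≟ q j
    ... | yes eq rewrite eq = ℕ.*-comm _ 1
    ... | no  _  = ℕ.*-zeroʳ (bit (not (does (q i ≟ q k))))

    C*C : ∀ i j k → C i k * C k j ≡ C k j * C i j
    C*C i j k with q k ≟ q j
    ... | yes eq rewrite eq = ℕ.*-comm _ 1
    ... | no  _  = ℕ.*-zeroʳ (C i k)

    C*a : ∀ i j k → C i k * a k j ≡ C k i * a i j
    C*a i j k rewrite adj-complement-friendship k j | adj-complement-friendship i j | C-sym i k with q k ≟ q i
    ... | yes eq rewrite eq = refl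
    ... | no  _  = refl

    sum-C* : ∀ j x (f : Fin (n * 2) → ℕ) → (∀ k → f k ≡ C k j * x) → sum f ≡ 2 * x
    sum-C* j x f h = trans (sum-cong-≗ h) (trans (sym (*-distribʳ-sum x (λ k → C k j))) (cong (_* x) (rowsum-C j)))

    -- The square of the all-ones matrix a + C is expanded. Both a and C are constant on pairs and
    -- every pair has two elements, so aC = Ca = 2a and CC = 2C. Using a + C = 1 once more turns the
    -- result into a² + 2a + 2 = 2n entrywise.
    paths : ∀ i j → sum (λ k → a i k * a k j) + 4 * a i j + 2 * C i j ≡ n * 2
    paths i j = begin
      sum (λ k → a i k * a k j) + 4 * a i j + 2 * C i j
        ≡⟨ solve 3 (λ s x y → s :+ con 4 :* x :+ con 2 :* y := (s :+ con 2 :* x) :+ (con 2 :* x :+ con 2 :* y)) refl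
             (sum λ k → a i k * a k j) (a i j) (C i j) ⟩
      (sum (λ k → a i k * a k j) + 2 * a i j) + (2 * a i j + 2 * C i j)
        ≡⟨ cong₂ _+_ (cong (sum (λ k → a i k * a k j) +_) (sum-C* j (a i j) _ (a*C i j)))
                     (cong₂ _+_ (sum-C* i (a i j) _ (C*a i j)) (sum-C* j (C i j) _ (C*C i j))) ⟨
      (sum (λ k → a i k * a k j) + sum (λ k → a i k * C k j)) +
      (sum (λ k → C i k * a k j) + sum (λ k → C i k * C k j))
        ≡⟨ cong₂ _+_ (∑-distrib-+ (λ k → a i k * a k j) (λ k → a i k * C k j))
                     (∑-distrib-+ (λ k → C i k * a k j) (λ k → C i k * C k j)) ⟨
      sum (λ k → a i k * a k j + a i k * C k j) + sum (λ k → C i k * a k j + C i k * C k j)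
        ≡⟨ ∑-distrib-+ (λ k → a i k * a k j + a i k * C k j) (λ k → C i k * a k j + C i k * C k j) ⟨
      sum (λ k → a i k * a k j + a i k * C k j + (C i k * a k j + C i k * C k j))
        ≡⟨ sum-cong-≗ (λ k → trans
             (solve 4 (λ x y u v → x :* u :+ x :* v :+ (y :* u :+ y :* v) := (x :+ y) :* (u :+ v)) refl
               (a i k) (C i k) (a k j) (C k j))
             (cong₂ _*_ (a+C i k) (a+C k j))) ⟩
      (sum {n * 2} λ k → 1)
        ≡⟨ trans (sum-constant (n * 2) 1) (ℕ.*-identityʳ _) ⟩
      n * 2 ∎

  paths′ : ∀ i j → sum (λ k → a i k * a k j) + 2 * a i j + 2 ≡ n * 2
  paths′ i j = trans (trans (cong (λ x → sum (λ k → a i k * a k j) + 2 * a i j + 2 * x) (sym (a+C i j)))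
    (solve 3 (λ s x y → s :+ con 2 :* x :+ con 2 :* (x :+ y) := s :+ con 4 :* x :+ con 2 :* y) refl
       (sum λ k → a i k * a k j) (a i j) (C i j))) (paths i j)

onRim : ∀ {n} → Fin (suc n) → ℕ
onRim zero    = 0
onRim (suc _) = 1

-- The nonzero block has the constant entry 2n - 2. Counting the triangles as `suc n` makes this
-- constant `n * 2`, free of subtraction.
A²+2A-complement-friendship : ∀ n i j →
  A²+2A (adjacency (complement (friendship (suc n)))) i j ≡ (n * 2) * (onRim i * onRim j)
A²+2A-complement-friendship n = entry
  where
  A : SqMat (suc (suc n * 2))
  A = adjacency (complement (friendship (suc n)))

  Ai0 : ∀ i → A i zero ≡ 0
  Ai0 i = cong bit (adj-complement-friendship-zeroʳ {suc n} i)

  A0j : ∀ j → A zero j ≡ 0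
  A0j j = trans (cong bit (symmetric (complement (friendship (suc n))) zero j)) (Ai0 j)

  entry : ∀ i j → A²+2A A i j ≡ (n * 2) * (onRim i * onRim j)
  entry zero    j       = trans
    (cong₂ (λ s x → s + 2 * x) (sum-zero λ k → cong (_* A k j) (A0j k)) (A0j j)) (sym (ℕ.*-zeroʳ (n * 2)))
  entry (suc i) zero    = trans
    (cong₂ (λ s x → s + 2 * x)
      (sum-zero λ k → trans (cong (A (suc i) k *_) (Ai0 k)) (ℕ.*-zeroʳ (A (suc i) k))) (Ai0 (suc i)))
    (sym (ℕ.*-zeroʳ (n * 2)))
  entry (suc i) (suc j) = trans
    (ℕ.+-cancelʳ-≡ 2 _ _ (trans (paths′ {suc n} i j) (ℕ.+-comm 2 (n * 2)))) (sym (ℕ.*-identityʳ (n * 2)))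

rankOneTrace-complement-friendship : ∀ n → RankOneTrace (A²+2A (adjacency (complement (friendship (suc n)))))
rankOneTrace-complement-friendship n = outerProduct⇒rankOneTrace _ (n * 2) onRim (A²+2A-complement-friendship n)

trace-complement-friendship : ∀ n →
  trace (A²+2A (adjacency (complement (friendship (suc n))))) ≡ suc n * 2 * (n * 2)
trace-complement-friendship n = trans (sum-cong-≗ λ i → A²+2A-complement-friendship n i i)
  (trans (cong₂ _+_ (ℕ.*-zeroʳ (n * 2)) (sum-cong-≗ {suc n * 2} λ _ → ℕ.*-identityʳ (n * 2)))
    (sum-constant (suc n * 2) (n * 2)))

injective⇒surjective : ∀ {m n} {f : Fin m → Fin n} → n ≤ m → Injective _≡_ _≡_ f → ∀ y → ∃[ x ] f x ≡ y
injective⇒surjective {n = suc n} {f} n<m f-injective y with any? (λ x → f x ≟ y)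
... | yes p = p
... | no ¬p = contradiction
  (λ {i} {j} eq → f-injective (punchOut-injective (λ y≡ → ¬p (i , sym y≡)) (λ y≡ → ¬p (j , sym y≡)) eq))
  (<⇒notInjective n<m)

positive : ℕ → Bool
positive zero    = false
positive (suc _) = true

-- The structure of a cospectral graph

-- The right side lies between consecutive values of the left: (c + 3)(c + 1) is (c + 2)² - 1, while
-- (c + 4)(c + 1) is (c + 2)² + c. So q is at least 3, and any excess of q over 3 as well as c
-- itself must vanish.
one-factor : ∀ c q → (c + suc q) * (c + 1) ≡ (c + 2) * (c + 2) → c ≡ 0 × q ≡ 3
one-factor c q eq with q ℕ.<? 3
... | yes (s≤s q≤2) = contradiction eq (ℕ.<⇒≢ (ℕ.≤-trans
  (s≤s (ℕ.*-monoˡ-≤ (c + 1) (ℕ.+-monoʳ-≤ c (s≤s q≤2))))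
  (ℕ.≤-reflexive
    (solve 1 (λ c → con 1 :+ (c :+ con 3) :* (c :+ con 1) := (c :+ con 2) :* (c :+ con 2)) refl c))))
... | no q≮3 with r , refl ← ℕ.m≤n⇒∃[o]m+o≡n (ℕ.≮⇒≥ q≮3) = c≡0 , cong (3 +_)
    (trans (sym (ℕ.*-identityʳ r)) (subst (λ c → r * (c + 1) ≡ 0) c≡0 (ℕ.m+n≡0⇒n≡0 c rest≡0)))
  where
  rest≡0 : c + r * (c + 1) ≡ 0
  rest≡0 = ℕ.+-cancelˡ-≡ ((c + 2) * (c + 2)) _ 0 (trans
    (solve 2 (λ c r → (c :+ con 2) :* (c :+ con 2) :+ (c :+ r :* (c :+ con 1)) :=
                      (c :+ (con 4 :+ r)) :* (c :+ con 1)) refl c r)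
    (trans eq (sym (ℕ.+-identityʳ _))))
  c≡0 : c ≡ 0
  c≡0 = ℕ.m+n≡0⇒m≡0 c rest≡0

-- Two parts of size at least 3 make the left side too large, a part of size 2 forces the other to
-- have size 2, and a part of size 1 falls under `one-factor`. The bound 5 is the number of vertices
-- of K_{1,4}.
quadratic : ∀ c p q → (c + suc q) * (c + suc p) ≡ (c + 2) * (c + 2) → p ≡ 1 ⊎ c + suc p + suc q ≤ 5
quadratic c 1             q             eq = inj₁ refl
quadratic c p             1             eq = inj₁ (ℕ.suc-injective (ℕ.+-cancelˡ-≡ c _ _
  (ℕ.*-cancelˡ-≡ (c + suc p) (c + 2) (c + 2) ⦃ ℕ.>-nonZero (ℕ.<-≤-trans z<s (ℕ.m≤n+m 2 c)) ⦄ eq)))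
quadratic c 0             q             eq with refl , refl ← one-factor c q eq = inj₂ ℕ.≤-refl
quadratic c (suc (suc p)) 0             eq
  with refl , refl ← one-factor c (suc (suc p)) (trans (ℕ.*-comm (c + suc (suc (suc p))) (c + 1)) eq)
  = inj₂ ℕ.≤-refl
quadratic c (suc (suc p)) (suc (suc q)) eq = contradiction (sym eq) (ℕ.<⇒≢
  (ℕ.*-mono-< (ℕ.+-monoʳ-< c (s<s (s<s z<s))) (ℕ.+-monoʳ-< c (s<s (s<s z<s)))))

module _ {N} (H : Graph N) where
  private
    a : SqMat N
    a = adjacency H

  degree : Fin N → ℕ
  degree i = sum (a i)

  codegree : Fin N → Fin N → ℕ
  codegree i j = sum λ k → a i k * a k j

  active : Fin N → Bool
  active i = positive (degree i)

  χ : Fin N → ℕ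
  χ i = bit (active i)

  support : ℕ
  support = sum χ

  codegree-sym : ∀ i j → codegree i j ≡ codegree j i
  codegree-sym i j = sum-cong-≗ λ k → trans (ℕ.*-comm (a i k) (a k j))
    (cong₂ (λ x y → bit x * bit y) (symmetric H k j) (symmetric H i k))

  bit-idem : ∀ b → bit b * bit b ≡ bit b
  bit-idem true  = refl
  bit-idem false = refl

  diagonal : ∀ i → A²+2A a i i ≡ degree i
  diagonal i = trans
    (cong₂ (λ s b → s + 2 * bit b)
      (sum-cong-≗ λ k → trans (cong (λ b → a i k * bit b) (symmetric H k i)) (bit-idem (adj H i k)))
      (loopless H i))
    (ℕ.+-identityʳ _)

  bit≤1 : ∀ b → bit b ≤ 1
  bit≤1 true  = s≤s z≤n
  bit≤1 false = z≤n

  adj⇒0<degree : ∀ {i k} → adj H i k ≡ true → 0 < degree i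
  adj⇒0<degree {i} {k} ik = ℕ.≤-trans (ℕ.≤-reflexive (cong bit (sym ik))) (term≤sum (a i) k)

  0<⇒positive : ∀ {m} → 0 < m → positive m ≡ true
  0<⇒positive z<s = refl

  positive⇒0< : ∀ {m} → positive m ≡ true → 0 < m
  positive⇒0< {suc m} _ = z<s

  adj⇒active : ∀ {i k} → adj H i k ≡ true → active i ≡ true
  adj⇒active = 0<⇒positive ∘ adj⇒0<degree

  adj⇒activeʳ : ∀ {i k} → adj H i k ≡ true → active k ≡ true
  adj⇒activeʳ {i} {k} ik = adj⇒active (trans (symmetric H k i) ik)

  active⇒neighbour : ∀ {i} → active i ≡ true → ∃[ j ] adj H i j ≡ true
  active⇒neighbour {i} act with any? (λ j → adj H i j Bool.≟ true)
  ... | yes p = p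
  ... | no ¬p = contradiction (positive⇒0< act) (ℕ.<-irrefl (sym (sum-zero λ j →
                  cong bit (Bool.¬-not (λ ij → ¬p (j , ij))))))

  module _ (minors : ∀ i j → A²+2A a i i * A²+2A a j j ≡ A²+2A a i j * A²+2A a i j) where

    degrees : ∀ i j → degree i * degree j ≡ (codegree i j + 2 * a i j) * (codegree i j + 2 * a i j)
    degrees i j = trans (sym (cong₂ _*_ (diagonal i) (diagonal j))) (minors i j)

    *-bit≤ˡ : ∀ x b → x * bit b ≤ x
    *-bit≤ˡ x b = ℕ.≤-trans (ℕ.*-monoʳ-≤ x (bit≤1 b)) (ℕ.≤-reflexive (ℕ.*-identityʳ x))

    *-bit≤ʳ : ∀ b x → bit b * x ≤ x
    *-bit≤ʳ b x = ℕ.≤-trans (ℕ.*-monoˡ-≤ x (bit≤1 b)) (ℕ.≤-reflexive (ℕ.*-identityˡ x))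

    -- deg i · deg k = codeg(i,k)² and codeg(i,k) ≤ deg i, deg k force codeg(i,k) = deg i.
    nonadjacent-twins : ∀ {i k} → active k ≡ true → adj H i k ≡ false →
                        ∀ {l} → adj H i l ≡ true → adj H k l ≡ true
    nonadjacent-twins {i} {k} k-active ik {l} il = trans (symmetric H k l) (bit-true (begin
        bit (adj H l k)
          ≡⟨ ℕ.*-identityˡ _ ⟨
        1 * a l k
          ≡⟨ cong (λ b → bit b * a l k) il ⟨
        a i l * a l k
          ≡⟨ sum-squeeze (λ l → *-bit≤ˡ (a i l) (adj H l k)) degree≤codegree l ⟩
        a i l
          ≡⟨ cong bit il ⟩
        1 ∎))
      where
      bit-true : ∀ {b} → bit b ≡ 1 → b ≡ true
      bit-true {true} _ = refl

      c : ℕ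
      c = codegree i k

      c≤degree : c ≤ degree k
      c≤degree = sum-mono λ l → ℕ.≤-trans (*-bit≤ʳ (adj H i l) (a l k))
        (ℕ.≤-reflexive (cong bit (symmetric H l k)))

      square : degree i * degree k ≡ c * c
      square = trans (degrees i k)
        (cong (λ x → x * x) (trans (cong (λ b → c + 2 * bit b) ik) (ℕ.+-identityʳ c)))

      degree≤codegree : degree i ≤ c
      degree≤codegree = ℕ.≮⇒≥ λ c<degree → ℕ.<⇒≢ (ℕ.≤-<-trans (ℕ.*-monoʳ-≤ c c≤degree)
        (ℕ.*-monoˡ-< (degree k) ⦃ ℕ.>-nonZero (positive⇒0< k-active) ⦄ c<degree)) (sym square)

    -- Inclusion-exclusion for the neighbourhoods of i and j, which together cover all active
    -- vertices: an active k not adjacent to i has the neighbours of i, and j is one of them.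
    support+codegree : ∀ {i j} → adj H i j ≡ true → support + codegree i j ≡ degree i + degree j
    support+codegree {i} {j} ij = trans (sym (∑-distrib-+ χ (λ k → a i k * a k j)))
      (trans (sum-cong-≗ pointwise) (∑-distrib-+ (a i) (a j)))
      where
      pointwise : ∀ k → χ k + a i k * a k j ≡ a i k + a j k
      pointwise k rewrite symmetric H k j with adj H i k in ik | adj H j k in jk
      ... | true  | true  = cong (λ b → bit b + 1) (adj⇒activeʳ ik)
      ... | true  | false = cong (λ b → bit b + 0) (adj⇒activeʳ ik)
      ... | false | true  = cong (λ b → bit b + 0) (adj⇒activeʳ jk)
      ... | false | false with active k in k-active
      ...   | false = refl
      ...   | true  = contradiction
              (trans (sym jk) (trans (symmetric H j k) (nonadjacent-twins k-active ik ij))) λ ()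

    codegree<degreeʳ : ∀ {i j} → adj H i j ≡ true → codegree i j < degree j
    codegree<degreeʳ {i} {j} ij = sum-mono-<
      (λ k → ℕ.≤-trans (*-bit≤ʳ (adj H i k) (a k j)) (ℕ.≤-reflexive (cong bit (symmetric H k j))))
      -- Strictness comes from i itself, a neighbour of j but not a common neighbour of i and j.
      i (subst (λ b → bit b * a i j < a j i) (sym (loopless H i))
          (subst (λ b → 0 < bit b) (sym (trans (symmetric H j i) ij)) z<s))

    -- p + 1 and q + 1 are the sizes of the parts of i and j.
    record Edge (i j : Fin N) : Set where
      field
        c p q : ℕ
        degreeʳ≡  : degree j ≡ c + suc p
        degreeˡ≡  : degree i ≡ c + suc q
        support≡  : support ≡ c + suc p + suc q
        minor≡    : (c + suc q) * (c + suc p) ≡ (c + 2) * (c + 2)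

    edge : ∀ {i j} → adj H i j ≡ true → Edge i j
    edge {i} {j} ij
      with p , p≡ ← ℕ.m≤n⇒∃[o]m+o≡n (codegree<degreeʳ ij)
         | q , q≡ ← ℕ.m≤n⇒∃[o]m+o≡n (subst (_< degree i) (codegree-sym j i)
                       (codegree<degreeʳ (trans (symmetric H j i) ij))) = record
      { c = c ; p = p ; q = q
      ; degreeʳ≡ = dj
      ; degreeˡ≡ = di
      ; support≡ = ℕ.+-cancelʳ-≡ c _ _ (trans (support+codegree ij) (trans (cong₂ _+_ di dj)
          (solve 3 (λ c p q → (c :+ q) :+ (c :+ p) := c :+ p :+ q :+ c) refl c (suc p) (suc q))))
      ; minor≡ = trans (sym (cong₂ _*_ di dj)) (trans (degrees i j)
          (cong (λ b → (c + 2 * bit b) * (c + 2 * bit b)) ij))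
      }
      where
      c = codegree i j
      dj : degree j ≡ c + suc p
      dj = trans (sym p≡) (sym (ℕ.+-suc c p))
      di : degree i ≡ c + suc q
      di = trans (sym q≡) (sym (ℕ.+-suc c q))

    -- More than five active vertices exclude K_{1,4}, so the part of i has size two and i is
    -- adjacent to every other active vertex outside it.
    active⇒degree : 6 ≤ support → ∀ {i} → active i ≡ true → degree i + 2 ≡ support
    active⇒degree 6≤s {i} i-active with j , ij ← active⇒neighbour i-active = case quadratic c p q minor≡ of λ where
        (inj₂ s≤5)  → contradiction s≤5 (ℕ.<⇒≱ (subst (5 <_) support≡ 6≤s))
        (inj₁ p≡1)  → trans (cong (_+ 2) degreeˡ≡) (trans
          (solve 2 (λ c q → c :+ q :+ con 2 := c :+ con 2 :+ q) refl c (suc q))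
          (sym (trans support≡ (cong (λ p → c + suc p + suc q) p≡1))))
      where
      open Edge (edge ij)

    -- Here d stands for 2n - 2: the condition n ≥ 3 becomes `4 ≤ d`, and `d + 2` is the desired
    -- number of active vertices.
    module _ {d} (4≤d : 4 ≤ d) (trace≡ : trace (A²+2A a) ≡ (d + 2) * d) where

      handshake : sum degree ≡ (d + 2) * d
      handshake = trans (sum-cong-≗ (sym ∘ diagonal)) trace≡

      degree<support : ∀ i → degree i + χ i ≤ support * χ i
      degree<support i with degree i in eq
      ... | zero  = z≤n
      ... | suc e with j , ij ← active⇒neighbour {i} (subst (λ m → positive m ≡ true) (sym eq) refl) =
        ℕ.≤-trans (ℕ.≤-trans (ℕ.≤-reflexive (cong (_+ 1) (trans (sym eq) degreeˡ≡)))
          (ℕ.≤-trans (ℕ.+-monoʳ-≤ (c + suc q) (s≤s (z≤n {p}))) (ℕ.≤-reflexive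
            (trans (solve 3 (λ c p q → c :+ q :+ p := c :+ p :+ q) refl c (suc p) (suc q)) (sym support≡)))))
          (ℕ.≤-reflexive (sym (ℕ.*-identityʳ support)))
        where
        open Edge (edge ij)

      handshake-bound : (d + 2) * d + support ≤ support * support
      handshake-bound = ℕ.≤-trans (ℕ.≤-reflexive (cong (_+ support) (sym handshake)))
        (ℕ.≤-trans (ℕ.≤-reflexive (sym (∑-distrib-+ degree χ)))
          (ℕ.≤-trans (sum-mono degree<support) (ℕ.≤-reflexive (sym (*-distribˡ-sum support χ)))))

      -- Degrees on at most five active vertices sum to at most 5 · 4 = 20, but d ≥ 4 makes the sum
      -- at least 6 · 4 = 24.
      6≤support : 6 ≤ support
      6≤support = ℕ.≰⇒> λ s≤5 → ℕ.<⇒≱ {20} {24} (ℕ.m≤m+n 21 3)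
        (ℕ.≤-trans (ℕ.*-mono-≤ (ℕ.+-monoˡ-≤ 2 4≤d) 4≤d) (ℕ.≤-trans (ℕ.+-cancelʳ-≤ support _ _
          (ℕ.≤-trans handshake-bound (ℕ.≤-trans (ℕ.*-monoˡ-≤ support s≤5) (ℕ.≤-reflexive (ℕ.+-comm support _)))))
          (ℕ.*-monoʳ-≤ 4 s≤5)))

      degree+2χ : ∀ i → degree i + 2 * χ i ≡ support * χ i
      degree+2χ i with active i in i-active
      ... | true  = trans (active⇒degree 6≤support i-active) (sym (ℕ.*-identityʳ support))
      ... | false = trans (trans (ℕ.+-identityʳ _) (inactive i-active)) (sym (ℕ.*-zeroʳ support))
        where
        inactive : ∀ {m} → positive m ≡ false → m ≡ 0
        inactive {zero} _ = refl

      -- Each of the s active vertices has degree s - 2, so (s - 2) s = d (d + 2). With r = s - 2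
      -- both sides are values of the strictly increasing function x (x + 2).
      support≡d+2 : support ≡ d + 2
      support≡d+2 with r , 2+r≡s ← ℕ.m≤n⇒∃[o]m+o≡n {2} (ℕ.≤-trans (ℕ.m≤m+n 2 4) 6≤support) =
        trans (sym 2+r≡s) (trans (ℕ.+-comm 2 r) (cong (_+ 2) (r≡d (ℕ.<-cmp r d))))
        where
        quadratic-support : (d + 2) * d + 2 * support ≡ support * support
        quadratic-support = trans (cong₂ _+_ (sym handshake) (*-distribˡ-sum 2 χ))
          (trans (sym (∑-distrib-+ degree (λ i → 2 * χ i)))
            (trans (sum-cong-≗ degree+2χ) (sym (*-distribˡ-sum support χ))))

        product≡ : (r + 2) * r ≡ (d + 2) * d
        product≡ = ℕ.+-cancelʳ-≡ (2 * (2 + r)) _ _ (trans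
          (solve 1 (λ r → (r :+ con 2) :* r :+ con 2 :* (con 2 :+ r) := (con 2 :+ r) :* (con 2 :+ r)) refl r)
          (sym (subst (λ s → (d + 2) * d + 2 * s ≡ s * s) (sym 2+r≡s) quadratic-support)))

        r≡d : Tri (r < d) (r ≡ d) (d < r) → r ≡ d
        r≡d (tri< r<d _ _) = contradiction product≡ (ℕ.<⇒≢ (ℕ.*-mono-< (ℕ.+-monoˡ-< 2 r<d) r<d))
        r≡d (tri≈ _ eq _)  = eq
        r≡d (tri> _ _ d<r) = contradiction (sym product≡) (ℕ.<⇒≢ (ℕ.*-mono-< (ℕ.+-monoˡ-< 2 d<r) d<r))

      -- For an active i the vertices k selected here, among them i itself, form the part of i.
      nonneighbour : Fin N → Fin N → Bool
      nonneighbour i k = active k ∧ not (adj H i k)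

      nonneighbours : ∀ {i} → active i ≡ true → sum (λ k → bit (nonneighbour i k)) ≡ 2
      nonneighbours {i} i-active = ℕ.+-cancelˡ-≡ (degree i) _ _ (trans
        (trans (sym (∑-distrib-+ (a i) (λ k → bit (nonneighbour i k)))) (sum-cong-≗ split))
        (sym (active⇒degree 6≤support i-active)))
        where
        split : ∀ k → a i k + bit (nonneighbour i k) ≡ χ k
        split k with adj H i k in ik
        ... | true  rewrite adj⇒activeʳ ik = refl
        ... | false = cong bit (Bool.∧-identityʳ (active k))

      nonneighbour⇒active : ∀ {i k} → nonneighbour i k ≡ true → active k ≡ true
      nonneighbour⇒active {i} {k} h with active k
      ... | true = refl

      nonneighbour⇒nonadjacent : ∀ {i k} → nonneighbour i k ≡ true → adj H i k ≡ false
      nonneighbour⇒nonadjacent {i} {k} h with active k | adj H i k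
      ... | true | false = refl

      -- The part of i has two elements; were i the only one, the count in `nonneighbours` would be
      -- at most 1.
      twin : ∀ {i} → active i ≡ true → ∃[ k ] (k ≢ i × nonneighbour i k ≡ true)
      twin {i} i-active with any? (λ k → ¬? (k ≟ i) ×-dec (nonneighbour i k Bool.≟ true))
      ... | yes p = p
      ... | no ¬p = contradiction (bit≤1 (nonneighbour i i)) (ℕ.<⇒≱ (ℕ.≤-reflexive (trans
              (sym (nonneighbours i-active))
              (sum-single i λ {k} k≢i → cong bit (Bool.¬-not λ h → ¬p (k , k≢i , h))))))

      isolated : N ≡ suc (d + 2) → ∃[ z ] active z ≡ false
      isolated N≡ with any? (λ z → active z Bool.≟ false)
      ... | yes p = p
      ... | no ¬p = contradiction (trans (sym support≡d+2) (trans (trans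
              (sum-cong-≗ λ k → cong bit (Bool.¬-not λ h → ¬p (k , h))) (sum-constant N 1))
              (trans (ℕ.*-identityʳ N) N≡))) (ℕ.<⇒≢ (ℕ.n<1+n _))

      -- A clique meets each part at most once. With as many vertices as there are parts it is a
      -- transversal, which labels the parts by `Fin j`.
      record Clique (j : ℕ) : Set where
        field
          vertex   : Fin j → Fin N
          isActive : ∀ x → active (vertex x) ≡ true
          adjacent : ∀ {x y} → x ≢ y → adj H (vertex x) (vertex y) ≡ true

      -- The j vertices of a clique have at most 2 j active nonneighbours in total, themselves included.
      clique : ∀ j → j * 2 ≤ support → Clique j
      clique zero    _     = record { vertex = λ () ; isActive = λ () ; adjacent = λ {x} → contradiction x ¬Fin0 }
      clique (suc j) j≤s with clique j (ℕ.≤-trans (ℕ.m≤n+m (j * 2) 2) j≤s)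
      ... | K with any? (λ v → (active v Bool.≟ true) ×-dec Fin.all? λ x → adj H (Clique.vertex K x) v Bool.≟ true)
      ... | yes (v , v-active , v-adj) = record
        { vertex   = v Vector.∷ vertex
        ; isActive = λ { zero → v-active ; (suc x) → isActive x }
        ; adjacent = extended
        }
        where
        open Clique K
        extended : ∀ {x y} → x ≢ y → adj H ((v Vector.∷ vertex) x) ((v Vector.∷ vertex) y) ≡ true
        extended {zero}  {zero}  x≢y = contradiction refl x≢y
        extended {zero}  {suc y} _   = trans (symmetric H v _) (v-adj y)
        extended {suc x} {zero}  _   = v-adj x
        extended {suc x} {suc y} x≢y = adjacent (x≢y ∘ cong suc)
      ... | no ¬p = contradiction j≤s (ℕ.<⇒≱ (s≤s (ℕ.≤-trans support≤ (ℕ.n≤1+n _))))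
        where
        open Clique K
        covered : ∀ v → χ v ≤ sum λ x → bit (nonneighbour (vertex x) v)
        covered v with active v in v-active
        ... | false = z≤n
        ... | true with any? (λ x → adj H (vertex x) v Bool.≟ false)
        ...   | yes (x , xv) = ℕ.≤-trans (ℕ.≤-reflexive (cong (bit ∘ not) (sym xv)))
                (term≤sum (λ x → bit (not (adj H (vertex x) v))) x)
        ...   | no ¬q = contradiction (v , v-active , λ x → Bool.¬-not λ h → ¬q (x , h)) ¬p

        support≤ : support ≤ j * 2
        support≤ = ℕ.≤-trans (sum-mono covered) (ℕ.≤-reflexive (trans
          (∑-comm (λ v x → bit (nonneighbour (vertex x) v)))
          (trans (sum-cong-≗ λ x → nonneighbours (isActive x)) (sum-constant j 2))))

      -- The isomorphism, from a transversal, the twins and an isolated vertex.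

      module _ {n} (n≡ : n * 2 ≡ d + 2) (N≡ : N ≡ suc (n * 2)) where
        open Clique (clique n (ℕ.≤-reflexive (trans n≡ (sym support≡d+2))))

        private
          z : Fin N
          z = proj₁ (isolated (trans N≡ (cong suc n≡)))

          z-isolated : ∀ v → adj H z v ≡ false
          z-isolated v = Bool.¬-not λ zv →
            contradiction (trans (sym (adj⇒active zv)) (proj₂ (isolated (trans N≡ (cong suc n≡))))) λ ()

          place : Fin n → Fin 2 → Fin N
          place x zero       = vertex x
          place x (suc zero) = proj₁ (twin (isActive x))

          twin-nonneighbour : ∀ x → nonneighbour (vertex x) (place x (suc zero)) ≡ true
          twin-nonneighbour x = proj₂ (proj₂ (twin (isActive x)))

          place-active : ∀ x s → active (place x s) ≡ true
          place-active x zero       = isActive x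
          place-active x (suc zero) = nonneighbour⇒active (twin-nonneighbour x)

          twin-nonadjacent : ∀ x → adj H (vertex x) (place x (suc zero)) ≡ false
          twin-nonadjacent x = nonneighbour⇒nonadjacent (twin-nonneighbour x)

          place-nonadjacent : ∀ x s t → adj H (place x s) (place x t) ≡ false
          place-nonadjacent x zero       zero       = loopless H _
          place-nonadjacent x zero       (suc zero) = twin-nonadjacent x
          place-nonadjacent x (suc zero) zero       = trans (symmetric H _ _) (twin-nonadjacent x)
          place-nonadjacent x (suc zero) (suc zero) = loopless H _

          place-vertex : ∀ x s {v} → adj H (vertex x) v ≡ true → adj H (place x s) v ≡ true
          place-vertex x zero       xv = xv
          place-vertex x (suc zero) xv =
            nonadjacent-twins (place-active x (suc zero)) (twin-nonadjacent x) xv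

          place-adjacent : ∀ {x y} s t → x ≢ y → adj H (place x s) (place y t) ≡ true
          place-adjacent {x} {y} s t x≢y = place-vertex x s (trans (symmetric H _ _)
            (place-vertex y t (adjacent (x≢y ∘ sym))))

          place-injective : ∀ x s t → place x s ≡ place x t → s ≡ t
          place-injective x zero       zero       eq = refl
          place-injective x zero       (suc zero) eq = contradiction (sym eq) (proj₁ (proj₂ (twin (isActive x))))
          place-injective x (suc zero) zero       eq = contradiction eq (proj₁ (proj₂ (twin (isActive x))))
          place-injective x (suc zero) (suc zero) eq = refl

          place≢z : ∀ x s → place x s ≢ z
          place≢z x s eq = contradiction (trans (sym (place-active x s))
            (trans (cong active eq) (proj₂ (isolated (trans N≡ (cong suc n≡)))))) λ ()

          q : Fin (n * 2) → Fin n
          q = quotient {n} 2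

          r : Fin (n * 2) → Fin 2
          r = remainder {n} 2

          -- The hub of the friendship graph is isolated in the complement and goes to `z`; quotient
          -- and remainder select the part and the vertex within it. In this direction only
          -- injectivity needs an argument, and the inverse comes from equal cardinalities.
          embed : Fin (suc (n * 2)) → Fin N
          embed zero    = z
          embed (suc i) = place (q i) (r i)

          embed-adj : ∀ i j → adj H (embed i) (embed j) ≡ adj (complement (friendship n)) i j
          embed-adj zero    j       = trans (z-isolated (embed j)) (sym (trans
            (symmetric (complement (friendship n)) zero j) (adj-complement-friendship-zeroʳ {n} j)))
          embed-adj (suc i) zero    = trans (symmetric H _ _) (z-isolated (embed (suc i)))
          embed-adj (suc i) (suc j) = trans same-part (sym (adj-complement-friendship {n} i j))
            where
            same-part : adj H (embed (suc i)) (embed (suc j)) ≡ not (does (q i ≟ q j))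
            same-part with q i ≟ q j
            ... | no  i≢j = place-adjacent (r i) (r j) i≢j
            ... | yes i≡j rewrite i≡j = place-nonadjacent (q j) (r i) (r j)

          embed-injective : ∀ {i j} → embed i ≡ embed j → i ≡ j
          embed-injective {zero}  {zero}  eq = refl
          embed-injective {zero}  {suc j} eq = contradiction (sym eq) (place≢z (q j) (r j))
          embed-injective {suc i} {zero}  eq = contradiction eq (place≢z (q i) (r i))
          embed-injective {suc i} {suc j} eq with q i ≟ q j
          -- Equal images from different pairs would be adjacent, giving a loop in H.
          ... | no  i≢j = contradiction
                  (trans (sym (place-adjacent (r i) (r j) i≢j))
                    (trans (cong (adj H (embed (suc i))) (sym eq)) (loopless H _))) λ ()
          ... | yes i≡j = cong suc (trans (sym (combine-remQuot {n} 2 i)) (trans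
                  (cong₂ combine i≡j (place-injective (q j) (r i) (r j)
                    (trans (cong (λ x → place x (r i)) (sym i≡j)) eq)))
                  (combine-remQuot {n} 2 j)))

          embed⁻¹ : ∀ v → ∃[ i ] embed i ≡ v
          embed⁻¹ = injective⇒surjective (ℕ.≤-reflexive N≡) embed-injective

        ≅-complement-friendship : H ≅ complement (friendship n)
        ≅-complement-friendship =
          permutation (proj₁ ∘ embed⁻¹) embed
            (λ i → embed-injective (proj₂ (embed⁻¹ (embed i)))) (proj₂ ∘ embed⁻¹) ,
          λ u v → trans (sym (cong₂ (adj H) (proj₂ (embed⁻¹ u)) (proj₂ (embed⁻¹ v))))
            (embed-adj (proj₁ (embed⁻¹ u)) (proj₁ (embed⁻¹ v)))

closedWalks-0 : ∀ {n} (A : SqMat n) → closedWalks A 0 ≡ n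
closedWalks-0 {n} A = trans (sum-cong-≗ {n} λ i → cong bit (dec-true (i ≟ i) refl))
  (trans (sum-constant n 1) (ℕ.*-identityʳ n))

theorem4p4 : ∀ {c ℓ₁ ℓ₂} (K : HeytingField c ℓ₁ ℓ₂) → Spectrum.CharacteristicZero K →
    ∀ (n : ℕ) → 3 ≤ n → ∀ {m : ℕ} (H : Graph m) →
    Spectrum.Cospectral K H (complement (friendship n)) → H ≅ complement (friendship n)
theorem4p4 K char0 (suc n) (s≤s 2≤n) {m} H cospectral = ≅-complement-friendship H minors
    (ℕ.*-monoˡ-≤ 2 2≤n)
    (trans trace≡ (trans (trace-complement-friendship n) (cong (_* (n * 2)) (ℕ.+-comm 2 (n * 2)))))
    -- Closed walks of length 0 count vertices, and this gives the order of H, which cospectrality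
    -- does not presuppose.
    (ℕ.+-comm 2 (n * 2)) (trans (sym (closedWalks-0 A)) (trans (walks 0) (closedWalks-0 B)))
  where
  A : SqMat m
  A = adjacency H

  B : SqMat (suc (suc n * 2))
  B = adjacency (complement (friendship (suc n)))

  walks : ∀ t → closedWalks A t ≡ closedWalks B t
  walks = cospectral⇒closedWalks K char0 {G = H} {complement (friendship (suc n))} cospectral

  trace≡ : trace (A²+2A A) ≡ trace (A²+2A B)
  trace≡ = trace-A²+2A A B walks

  A-sym : ∀ i j → A²+2A A i j ≡ A²+2A A j i
  A-sym i j = cong₂ (λ x b → x + 2 * bit b) (codegree-sym H i j) (symmetric H i j)

  minors : ∀ i j → A²+2A A i i * A²+2A A j j ≡ A²+2A A i j * A²+2A A i j
  minors = rankOneTrace⇒minors-vanish (A²+2A A) A-sym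
    (rankOneTrace-transfer A B walks (rankOneTrace-complement-friendship n))
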